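{- (In ZFC set theory.) For a graph $G$ the following are equivalent: (a) $G$ is a generalized Cayley graph of a quasigroup; (b) $G$ is a generalized Cayley graph of a quasigroup with a left identity; (c) $G$ is simple, deterministic, co-deterministic, co-regular, source-complete and target-complete. Likewise, the following are equivalent: (a') $G$ is a generalized Cayley graph of a quasigroup with a right identity; (b') $G$ is a generalized Cayley graph of a quasigroup with an identity; (c') $G$ is simple, deterministic, co-deterministic, co-regular, source-complete, target-complete and loop-complete.
   Context: A graph is a non-empty set $G\subseteq V\times A\times V$ of labeled edges $s\xrightarrow{a}_G t$; $s\to_G t$ means such an edge exists for some $a$; $V_G$ is the set of vertices occurring in edges, $A_G$ the set of labels. A graph is a generalized Cayley graph of a magma $(M,\cdot)$ if it equals $\mathcal{C}\langle M,Q\rangle=\{(p,\langle q\rangle,p\cdot q): p\in M,\ q\in Q\}$ for some $Q\subseteq M$ and injective $\langle\,\rangle:Q\to A$. A quasigroup is a magma in which for all $p,q$ there is a unique $r$ with $p\cdot r=q$ and a unique $s$ with $s\cdot p=q$. Left identity: $e\cdot p=p$ for all $p$; right identity: $p\cdot e=p$ for all $p$; identity: both. $G$ is simple if no two edges share source and target; deterministic if $r\xrightarrow{a}s$, $r\xrightarrow{a}t$ imply $s=t$; co-deterministic if $s\xrightarrow{a}r$, $t\xrightarrow{a}r$ imply $s=t$; source-complete if for all $s\in V_G$, $a\in A_G$ there is $t$ with $s\xrightarrow{a}_G t$; target-complete if for all $t\in V_G$, $a\in A_G$ there is $s$ with $s\xrightarrow{a}_G t$; loop-complete if whenever some vertex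 has an $a$-labeled loop, every vertex has an $a$-labeled loop. Let $S=\{(s,t)\in V_G\times V_G: \text{no edge } s\to_G t\}$; $G$ is co-regular if $S$ is a regular relation on $V_G$, meaning that for all $s\in V_G$, $|S(s)|=|S^{ -1}(s)|=\Delta_S$, where $S(s)=\{t:(s,t)\in S\}$, $S^{ -1}(s)=\{t:(t,s)\in S\}$ and $\Delta_S$ is the supremum of all these cardinals. -}

module Defs where

open import Data.Product using (Σ; ∃; ∃-syntax; _×_; _,_)
open import Data.Sum using (_⊎_)
open import Relation.Nullary using (¬_; Dec)
open import Relation.Binary.PropositionalEquality using (_≡_)
open import Induction.WellFounded using (WellFounded)
open import Relation.Binary.Definitions using (Trichotomous; Transitive)

_⇔_ : ∀ {a b} → Set a → Set b → Set _
P ⇔ Q = (P → Q) × (Q → P)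

Injective : {X Y : Set} → (X → Y) → Set
Injective f = ∀ x y → f x ≡ f y → x ≡ y

-- Ambient classical (ZFC) principles: excluded middle and the
-- well-ordering theorem (equivalent to the axiom of choice).
record Classical : Set₁ where
  field
    lem : (P : Set) → Dec P
    well-order : (X : Set) →
      Σ (X → X → Set) λ _<_ →
        WellFounded _<_ × Transitive _<_ × Trichotomous _≡_ _<_

-- A graph with vertices in V and labels in A is a set of labeled edges,
-- i.e. a predicate on V × A × V; it must be non-empty.
Graph : Set → Set → Set₁
Graph V A = V → A → V → Set

module _ {V A : Set} (G : Graph V A) where

  NonEmpty : Set
  NonEmpty = ∃[ s ] ∃[ a ] ∃[ t ] G s a t

  Arrow : V → V → Set
  Arrow s t = ∃[ a ] G s a t

  InV : V → Set
  InV v = (∃[ a ] ∃[ t ] G v a t) ⊎ (∃[ s ] ∃[ a ] G s a v)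

  InA : A → Set
  InA a = ∃[ s ] ∃[ t ] G s a t

  Simple : Set
  Simple = ∀ s t a b → G s a t → G s b t → a ≡ b

  Deterministic : Set
  Deterministic = ∀ r s t a → G r a s → G r a t → s ≡ t

  CoDeterministic : Set
  CoDeterministic = ∀ r s t a → G s a r → G t a r → s ≡ t

  SourceComplete : Set
  SourceComplete = ∀ s a → InV s → InA a → ∃[ t ] G s a t

  TargetComplete : Set
  TargetComplete = ∀ t a → InV t → InA a → ∃[ s ] G s a t

  LoopComplete : Set
  LoopComplete = ∀ a → (∃[ v ] G v a v) → ∀ v → InV v → G v a v

  NonArrow : V → V → Set
  NonArrow s t = InV s × InV t × ¬ Arrow s t

  HasCard : (V → Set) → Set → Set
  HasCard P D = Σ (D → V) λ f → Injective f × (∀ t → P t ⇔ (∃[ d ] f d ≡ t))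

  -- S is regular: all |S(s)| and |S⁻¹(s)| (s ∈ V_G) are equal to a common
  -- cardinal |D| (which then is their supremum Δ_S).
  CoRegular : Set₁
  CoRegular = Σ Set λ D → ∀ s → InV s →
    HasCard (λ t → NonArrow s t) D × HasCard (λ t → NonArrow t s) D

  -- G = 𝒞⟨M,Q⟩ for a magma (M,∙) with M ⊆ V, Q ⊆ M and an injective
  -- labelling ⟨_⟩ : Q → A.
  record CayleyRep : Set₁ where
    field
      M     : Set
      ιM    : M → V
      ιM-inj : Injective ιM
      _∙_   : M → M → M
      Q     : Set
      ιQ    : Q → M
      ιQ-inj : Injective ιQ
      ⟨_⟩   : Q → A
      ⟨⟩-inj : Injective ⟨_⟩
      edges : ∀ s a t → G s a t ⇔
        (∃[ p ] ∃[ q ] (s ≡ ιM p × a ≡ ⟨ q ⟩ × t ≡ ιM (p ∙ ιQ q)))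

  module _ (R : CayleyRep) where
    open CayleyRep R

    IsQuasigroup : Set
    IsQuasigroup = ∀ p q →
      (Σ M λ r → p ∙ r ≡ q × (∀ r' → p ∙ r' ≡ q → r' ≡ r)) ×
      (Σ M λ s → s ∙ p ≡ q × (∀ s' → s' ∙ p ≡ q → s' ≡ s))

    HasLeftIdentity : Set
    HasLeftIdentity = ∃[ e ] (∀ p → e ∙ p ≡ p)

    HasRightIdentity : Set
    HasRightIdentity = ∃[ e ] (∀ p → p ∙ e ≡ p)

    HasIdentity : Set
    HasIdentity = ∃[ e ] ((∀ p → e ∙ p ≡ p) × (∀ p → p ∙ e ≡ p))

  CayleyQuasigroup : Set₁
  CayleyQuasigroup = Σ CayleyRep IsQuasigroup

  CayleyQuasigroupLeftId : Set₁
  CayleyQuasigroupLeftId = Σ CayleyRep λ R → IsQuasigroup R × HasLeftIdentity R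

  CayleyQuasigroupRightId : Set₁
  CayleyQuasigroupRightId = Σ CayleyRep λ R → IsQuasigroup R × HasRightIdentity R

  CayleyQuasigroupId : Set₁
  CayleyQuasigroupId = Σ CayleyRep λ R → IsQuasigroup R × HasIdentity R

  CondC : Set₁
  CondC = Simple × Deterministic × CoDeterministic × CoRegular
          × SourceComplete × TargetComplete

  CondC' : Set₁
  CondC' = CondC × LoopComplete

{-# OPTIONS --safe #-}
module Submission where

-- For (a) ⇒ (c), the non-edges out of p are the products p ∙ m with m outside Q, and cancellation
-- makes the non-edges into p equally many. For (c) ⇒ (b), each label permutes the vertices, so
-- only the regular relation S of non-edges has to be split into permutations as well. The resulting
-- palette of permutations is sharply transitive: fixing a vertex r, name each vertex q by the
-- colour leading from r to q and let p ∙ q be the image of p under that colour; then r is a left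
-- identity, and it is a right identity if some colour acts as the identity. Loop-completeness
-- provides such a colour: a loop label, or else the diagonal, which is then removed from S first.
--
-- Splitting a D-regular bipartite relation into perfect matchings: if D is finite, remove perfect
-- matchings one by one; these exist by augmenting paths for finite sets of vertices, compactness,
-- and Cantor–Schröder–Bernstein. If D is infinite, a connected component has at most |D|
-- vertices because |D| · |D| = |D|, and |D| requirements ("every vertex sees every colour", "every
-- edge has a colour") are met one after another along an initial well-order of D, fewer than |D|
-- edges being coloured at each stage.

open import Defs
open import Data.Bool using (Bool; true; false)
open import Data.Bool.Properties using (T-irrelevant)
open import Data.Empty using (⊥-elim)
open import Data.Fin using (Fin; zero; suc; toℕ; fromℕ<; punchOut; combine)
open import Data.Fin.Properties using (toℕ-fromℕ<; pigeonhole; punchOut-injective; combine-injective)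
open import Data.List using (List; []; _∷_; length; map; concat)
open import Data.List.Membership.Propositional using (_∈_; _∉_)
open import Data.List.Membership.Propositional.Properties using (∈-map⁺; ∈-concat⁺′)
import Data.List.Membership.Setoid.Properties as Membership
open import Data.List.Relation.Unary.Any using (here; there; index)
open import Data.Nat as ℕ using (ℕ; zero; suc)
import Data.Nat.Properties as ℕ
open import Data.Nat.Induction using (<-wellFounded)
open import Data.Product using (Σ; ∃; ∃-syntax; _×_; _,_; proj₁; proj₂)
open import Data.Product.Relation.Binary.Lex.Strict using (×-Lex; ×-wellFounded)
open import Data.Sum using (_⊎_; inj₁; inj₂; [_,_])
open import Data.Sum.Properties using (inj₁-injective; inj₂-injective)
open import Data.Unit using (⊤; tt)
open import Function using (_∘_; id; _on_)
open import Induction.WellFounded using (WellFounded; WfRec; Acc; acc; module All; module FixPoint)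
open import Level using (0ℓ)
open import Relation.Binary.Construct.On using () renaming (wellFounded to on-wellFounded)
open import Relation.Binary.Definitions using (Trichotomous; Transitive; tri<; tri≈; tri>)
open import Relation.Binary.PropositionalEquality using (_≡_; _≢_; refl; sym; trans; cong; cong₂; subst; setoid)
open import Relation.Nullary using (¬_; contradiction; toSum)
open import Relation.Nullary.Decidable using (True; toWitness; fromWitness; decidable-stable)

-- Injections and finite sets.

infix 4 _≲_

_≲_ : Set → Set → Set
X ≲ Y = Σ (X → Y) Injective

≲-trans : {X Y Z : Set} → X ≲ Y → Y ≲ Z → X ≲ Z
≲-trans (f , f-inj) (g , g-inj) = g ∘ f , λ x y eq → f-inj x y (g-inj _ _ eq)

≲-× : {X X′ Y Y′ : Set} → X ≲ X′ → Y ≲ Y′ → (X × Y) ≲ (X′ × Y′)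
≲-× (f , f-inj) (g , g-inj) = (λ (x , y) → f x , g y) ,
  λ (x , y) (x′ , y′) eq → cong₂ _,_ (f-inj x x′ (cong proj₁ eq)) (g-inj y y′ (cong proj₂ eq))

Finite : Set → Set
Finite X = ∃[ n ] (X ≲ Fin n)

Finite-× : {X Y : Set} → Finite X → Finite Y → Finite (X × Y)
Finite-× (m , f) (n , g) = m ℕ.* n , ≲-trans (≲-× f g)
  ((λ (i , j) → combine i j) , λ (i , j) (k , l) eq → let (p , q) = combine-injective i j k l eq in cong₂ _,_ p q)

ℕ⋠finite : {X : Set} → ℕ ≲ X → ¬ Finite X
ℕ⋠finite ℕ≲X (n , X≲n) =
  let (f , f-inj) = ≲-trans ℕ≲X X≲n
      (i , j , i<j , eq) = pigeonhole (ℕ.n<1+n n) (f ∘ toℕ)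
  in ℕ.<⇒≢ i<j (f-inj _ _ eq)

-- Two equal iterates of `x₀` could be cancelled by injectivity until `x₀` itself became a value of
-- `h`.
ℕ-≲-orbit : {X : Set} (h : X → X) → Injective h → (x₀ : X) → (∀ x → h x ≢ x₀) → ℕ ≲ X
ℕ-≲-orbit h h-inj x₀ miss = orbit , orbit-inj
  where
  orbit : ℕ → _
  orbit zero = x₀
  orbit (suc n) = h (orbit n)
  orbit-inj : Injective orbit
  orbit-inj zero zero eq = refl
  orbit-inj zero (suc n) eq = ⊥-elim (miss _ (sym eq))
  orbit-inj (suc m) zero eq = ⊥-elim (miss _ eq)
  orbit-inj (suc m) (suc n) eq = cong suc (orbit-inj m n (h-inj _ _ eq))

-- Regular relations and their factorizations.

Enum : {Y : Set} → (Y → Set) → Set → Set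
Enum {Y} P D = Σ (D → Y) λ f → Injective f × (∀ t → P t ⇔ (∃[ d ] f d ≡ t))

Enum-cong : {Y D : Set} {P Q : Y → Set} → (∀ y → P y ⇔ Q y) → Enum P D → Enum Q D
Enum-cong P⇔Q (f , f-inj , f-img) = f , f-inj ,
  λ t → (λ q → proj₁ (f-img t) (proj₂ (P⇔Q t) q)) , (λ e → proj₁ (P⇔Q t) (proj₂ (f-img t) e))

Regular : {X Y : Set} → (X → Y → Set) → Set → Set
Regular R D = (∀ x → Enum (R x) D) × (∀ y → Enum (λ x → R x y) D)

record PerfectMatching {X Y : Set} (R : X → Y → Set) : Set where
  field
    fun        : X → Y
    edge       : ∀ x → R x (fun x)
    injective  : Injective fun
    surjective : ∀ y → ∃[ x ] fun x ≡ y

-- A 1-factorization. `distinct` compares two factors at a single point, so different factors share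
-- no edge.
record Factorization {X Y : Set} (R : X → Y → Set) (D : Set) : Set where
  field
    factor       : D → PerfectMatching R
  open module Factor (d : D) = PerfectMatching (factor d) public
  field
    distinct : ∀ c d x → fun c x ≡ fun d x → c ≡ d
    covering : ∀ x y → R x y → ∃[ d ] fun d x ≡ y

-- Well-orders.

record WellOrder (X : Set) : Set₁ where
  infix 4 _<_
  field
    _<_     : X → X → Set
    <-wf    : WellFounded _<_
    <-trans : Transitive _<_
    <-cmp   : Trichotomous _≡_ _<_

  <-irrefl : ∀ {x} → ¬ x < x
  <-irrefl {x} x<x with <-cmp x x
  ... | tri< _ x≢x _ = x≢x refl
  ... | tri≈ ¬x<x _ _ = ¬x<x x<x
  ... | tri> _ x≢x _ = x≢x refl

  ≢⇒<⊎> : ∀ {x y} → x ≢ y → x < y ⊎ y < x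
  ≢⇒<⊎> {x} {y} x≢y with <-cmp x y
  ... | tri< x<y _ _ = inj₁ x<y
  ... | tri≈ _ x≡y _ = ⊥-elim (x≢y x≡y)
  ... | tri> _ _ y<x = inj₂ y<x

  Least : (X → Set) → X → Set
  Least P x = P x × (∀ y → P y → ¬ y < x)

  -- Two predicates are allowed because equivalent predicates need not be equal; this makes choices
  -- by leastness canonical.
  Least-unique : ∀ {P Q x y} → (∀ z → P z ⇔ Q z) → Least P x → Least Q y → x ≡ y
  Least-unique {P} {Q} {x} {y} P⇔Q (px , x-min) (qy , y-min) with <-cmp x y
  ... | tri< x<y _ _ = ⊥-elim (y-min x (proj₁ (P⇔Q x) px) x<y)
  ... | tri≈ _ x≡y _ = x≡y
  ... | tri> _ _ y<x = ⊥-elim (x-min y (proj₂ (P⇔Q y) qy) y<x)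

pullback : {X Y : Set} → WellOrder Y → X ≲ Y → WellOrder X
pullback W (f , f-inj) = record
  { _<_ = λ x y → f x < f y
  ; <-wf = on-wellFounded f <-wf
  ; <-trans = <-trans
  ; <-cmp = cmp
  }
  where
  open WellOrder W
  cmp : Trichotomous _≡_ (λ x y → f x < f y)
  cmp x y with <-cmp (f x) (f y)
  ... | tri< a b c = tri< a (b ∘ cong f) c
  ... | tri≈ a b c = tri≈ a (f-inj x y b) c
  ... | tri> a b c = tri> a (b ∘ cong f) c

-- Classical choice and transfinite recursion.

module _ (classical : Classical) where
  open Classical classical

  em : (P : Set) → P ⊎ ¬ P
  em P = toSum (lem P)

  by-contradiction : {P : Set} → ¬ ¬ P → P
  by-contradiction {P} = decidable-stable (lem P)

  -- A proof-irrelevant subtype, so that the projection to X is injective.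
  Sub : {X : Set} → (X → Set) → Set
  Sub {X} P = Σ X λ x → True (lem (P x))

  sub : {X : Set} {P : X → Set} (x : X) → P x → Sub P
  sub {P = P} x p = x , fromWitness {a? = lem (P x)} p

  holds : {X : Set} {P : X → Set} (s : Sub P) → P (proj₁ s)
  holds s = toWitness (proj₂ s)

  Sub-≡ : {X : Set} {P : X → Set} {s t : Sub P} → proj₁ s ≡ proj₁ t → s ≡ t
  Sub-≡ {s = x , p} {t = .x , q} refl = cong (x ,_) (T-irrelevant p q)

  Sub-≲ : {X : Set} {P : X → Set} → Sub P ≲ X
  Sub-≲ = proj₁ , λ s t → Sub-≡

  Sub-mono : {X : Set} {P Q : X → Set} → (∀ x → P x → Q x) → Sub P ≲ Sub Q
  Sub-mono P⇒Q = (λ s → sub (proj₁ s) (P⇒Q _ (holds s))) , λ s t eq → Sub-≡ (cong proj₁ eq)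

  ≲-of-cover : {X Y : Set} → (Σ (X → Y) λ f → ∀ y → ∃[ x ] f x ≡ y) → Y ≲ X
  ≲-of-cover (f , onto) = proj₁ ∘ onto ,
    λ y y′ eq → trans (sym (proj₂ (onto y))) (trans (cong f eq) (proj₂ (onto y′)))

  wellOrder : (X : Set) → WellOrder X
  wellOrder X = let (_<_ , wf , tr , cmp) = well-order X in
    record { _<_ = _<_ ; <-wf = wf ; <-trans = tr ; <-cmp = cmp }

  opaque
    least : {X : Set} (W : WellOrder X) (P : X → Set) → ∃ P → ∃ (WellOrder.Least W P)
    least W P (x , px) = go x (<-wf x) px
      where
      open WellOrder W
      go : ∀ x → Acc _<_ x → P x → ∃ (Least P)
      go x (acc rs) px with em (∃[ y ] (P y × y < x))
      ... | inj₁ (y , py , y<x) = go y (rs y<x) py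
      ... | inj₂ none = x , px , λ y py y<x → none (y , py , y<x)

  -- Choosing least witnesses makes the recursion step extensional in the history,
  -- so that the recursion unfolds without function extensionality.
  module _ {W E : Set} {_≺_ : W → W → Set} (≺-wf : WellFounded _≺_)
           (e₀ : E) (Φ : W → (W → E) → E → Set)
           (local : ∀ w g g′ e → (∀ v → v ≺ w → g v ≡ g′ v) → Φ w g e → Φ w g′ e)
           (extend : ∀ w g → (∀ v → v ≺ w → Φ v g (g v)) → ∃ (Φ w g)) where

    private
      open module WE = WellOrder (wellOrder E) using (Least; Least-unique)

      choose : (P : E → Set) → Σ E λ e → ∃ P → Least P e
      choose P with em (∃ P)
      ... | inj₁ p = let (e , l) = least (wellOrder E) P p in e , λ _ → l
      ... | inj₂ ¬p = e₀ , λ p → ⊥-elim (¬p p)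

      choose-cong : ∀ {P Q} → (∀ e → P e ⇔ Q e) → proj₁ (choose P) ≡ proj₁ (choose Q)
      choose-cong {P} {Q} P⇔Q with em (∃ P) | em (∃ Q)
      ... | inj₁ p | inj₁ q = Least-unique P⇔Q (proj₂ (least (wellOrder E) P p)) (proj₂ (least (wellOrder E) Q q))
      ... | inj₁ (e , p) | inj₂ ¬q = ⊥-elim (¬q (e , proj₁ (P⇔Q e) p))
      ... | inj₂ ¬p | inj₁ (e , q) = ⊥-elim (¬p (e , proj₂ (P⇔Q e) q))
      ... | inj₂ _ | inj₂ _ = refl

      -- The history is made total with the default `e₀` at stages not below `w`; by `local`, `Φ`
      -- does not depend on those values.
      past : ∀ w → WfRec _≺_ (λ _ → E) w → W → E
      past w IH v with em (v ≺ w)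
      ... | inj₁ v≺w = IH v≺w
      ... | inj₂ _ = e₀

      past-cong : ∀ w {IH IH′ : WfRec _≺_ (λ _ → E) w} →
        (∀ {v} (v≺w : v ≺ w) → IH v≺w ≡ IH′ v≺w) → ∀ v → past w IH v ≡ past w IH′ v
      past-cong w eq v with em (v ≺ w)
      ... | inj₁ v≺w = eq v≺w
      ... | inj₂ _ = refl

      step : ∀ w → WfRec _≺_ (λ _ → E) w → E
      step w IH = proj₁ (choose (Φ w (past w IH)))

      step-ext : ∀ w {IH IH′ : WfRec _≺_ (λ _ → E) w} →
        (∀ {v} (v≺w : v ≺ w) → IH v≺w ≡ IH′ v≺w) → step w IH ≡ step w IH′
      step-ext w eq = choose-cong λ e →
        local w _ _ e (λ v _ → past-cong w eq v) , local w _ _ e (λ v _ → sym (past-cong w eq v))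

      g : W → E
      g = All.wfRec ≺-wf 0ℓ (λ _ → E) step

      past-g : ∀ w v → v ≺ w → g v ≡ past w (λ {u} _ → g u) v
      past-g w v v≺w with em (v ≺ w)
      ... | inj₁ _ = refl
      ... | inj₂ v⊀w = ⊥-elim (v⊀w v≺w)

    opaque
      greedy : Σ (W → E) λ g → ∀ w → Φ w g (g w)
      greedy = g , All.wfRec ≺-wf 0ℓ (λ w → Φ w g (g w)) λ w IH →
        -- `extend` applies to the finished `g`. By `local` its witness also serves for `past`,
        -- which is what the recursion saw, and the choice made there is carried back to `g`.
        let (e , φ) = extend w g (λ v v≺w → IH v≺w)
            (φ′ , _) = proj₂ (choose (Φ w (past w λ {u} _ → g u))) (e , local w _ _ e (past-g w) φ)
            unfold = FixPoint.unfold-wfRec ≺-wf (λ _ → E) step step-ext {w}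
        in subst (Φ w g) (sym unfold) (local w _ _ _ (λ v v≺w → sym (past-g w v v≺w)) φ′)

  -- Cardinal arithmetic

  opaque
    -- If `X` is not finite, no finite stage exhausts it, so each natural number can receive a value
    -- different from all earlier ones.
    finite-or-infinite : (X : Set) → Finite X ⊎ ℕ ≲ X
    finite-or-infinite X with em (Finite X)
    ... | inj₁ fin = inj₁ fin
    ... | inj₂ inf = inj₂ (separated seq)
      where
      x₀ : X
      x₀ = by-contradiction λ empty → inf (0 , (λ x → ⊥-elim (empty x)) , λ x → ⊥-elim (empty x))

      Fresh : ℕ → (ℕ → X) → X → Set
      Fresh n g x = ∀ k → k ℕ.< n → g k ≢ x

      fresh : ∀ n g → ∃ (Fresh n g)
      fresh n g = by-contradiction λ none → inf (n , ≲-of-cover ((g ∘ toℕ) , λ x →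
        let (k , k<n , eq) = by-contradiction {∃[ k ] (k ℕ.< n × g k ≡ x)}
                               λ unhit → none (x , λ k k<n eq → unhit (k , k<n , eq))
        in fromℕ< k<n , trans (cong g (toℕ-fromℕ< k<n)) eq))

      seq : Σ (ℕ → X) λ g → ∀ n → Fresh n g (g n)
      seq = greedy <-wellFounded x₀ Fresh
        (λ n g g′ x agree fr k k<n eq → fr k k<n (trans (agree k k<n) eq)) (λ n g _ → fresh n g)

      separated : (Σ (ℕ → X) λ g → ∀ n → Fresh n g (g n)) → ℕ ≲ X
      separated (g , g-fresh) = g , g-inj
        where
        g-inj : Injective g
        g-inj m n eq with ℕ.<-cmp m n
        ... | tri< m<n _ _ = ⊥-elim (g-fresh n m m<n eq)
        ... | tri≈ _ m≡n _ = m≡n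
        ... | tri> _ _ n<m = ⊥-elim (g-fresh m n n<m (sym eq))

  opaque
    -- Hilbert's hotel: move one step along an embedded copy of ℕ and fix everything else; the first
    -- room `h 0` becomes free.
    ℕ-≲-shift : {X : Set} → ℕ ≲ X → Σ (X → X) λ f → Injective f × (∃[ x₀ ] ∀ x → f x ≢ x₀)
    ℕ-≲-shift {X} (h , h-inj) = (λ x → proj₁ (shift x)) , shift-inj , h 0 , miss
      where
      shift : ∀ x → Σ X λ y → (∃[ k ] (h k ≡ x × y ≡ h (suc k))) ⊎ ((∀ k → h k ≢ x) × y ≡ x)
      shift x with em (∃[ k ] h k ≡ x)
      ... | inj₁ (k , eq) = h (suc k) , inj₁ (k , eq , refl)
      ... | inj₂ none = x , inj₂ ((λ k eq → none (k , eq)) , refl)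

      shift-inj : Injective (λ x → proj₁ (shift x))
      shift-inj x y eq with shift x | shift y
      ... | _ , inj₁ (k , refl , refl) | _ , inj₁ (l , refl , refl) = cong h (ℕ.suc-injective (h-inj _ _ eq))
      ... | _ , inj₁ (k , _ , refl) | _ , inj₂ (none , refl) = ⊥-elim (none _ eq)
      ... | _ , inj₂ (none , refl) | _ , inj₁ (k , _ , refl) = ⊥-elim (none _ (sym eq))
      ... | _ , inj₂ (_ , refl) | _ , inj₂ (_ , refl) = eq

      miss : ∀ x → proj₁ (shift x) ≢ h 0
      miss x eq with shift x
      ... | _ , inj₁ (k , _ , refl) = contradiction (h-inj _ _ eq) λ ()
      ... | _ , inj₂ (none , refl) = none 0 (sym eq)

  opaque
    -- A shift leaves some `x₀` free; the element that it sends to `y`, if there is one, is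
    -- redirected to `x₀`.
    ≲-minus-point : {X : Set} → ℕ ≲ X → (y : X) → X ≲ Sub (λ x → x ≢ y)
    ≲-minus-point {X} ℕ≲X y with ℕ-≲-shift ℕ≲X
    ... | f , f-inj , x₀ , f-miss = (λ x → sub (proj₁ (f′ x)) (avoid x)) , λ a b eq → f′-inj a b (cong proj₁ eq)
      where
      f′ : ∀ x → Σ X λ z → (f x ≡ y × z ≡ x₀) ⊎ (f x ≢ y × z ≡ f x)
      f′ x with em (f x ≡ y)
      ... | inj₁ eq = x₀ , inj₁ (eq , refl)
      ... | inj₂ ne = f x , inj₂ (ne , refl)

      avoid : ∀ x → proj₁ (f′ x) ≢ y
      avoid x eq with f′ x
      ... | _ , inj₁ (fx≡y , refl) = f-miss x (trans fx≡y (sym eq))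
      ... | _ , inj₂ (fx≢y , refl) = fx≢y eq

      f′-inj : Injective (λ x → proj₁ (f′ x))
      f′-inj a b eq with f′ a | f′ b
      ... | _ , inj₁ (p , refl) | _ , inj₁ (q , refl) = f-inj a b (trans p (sym q))
      ... | _ , inj₁ (p , refl) | _ , inj₂ (q , refl) = ⊥-elim (f-miss b (sym eq))
      ... | _ , inj₂ (p , refl) | _ , inj₁ (q , refl) = ⊥-elim (f-miss a eq)
      ... | _ , inj₂ (p , refl) | _ , inj₂ (q , refl) = f-inj a b eq

  Seg : {X : Set} → WellOrder X → X → Set
  Seg W d = Sub (λ x → WellOrder._<_ W x d)

  -- The order type is an initial ordinal, that is, a cardinal.
  Initial : {X : Set} → WellOrder X → Set
  Initial {X} W = ∀ d → ¬ (X ≲ Seg W d)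

  opaque
    -- Pull the order back from the least segment that still receives `X`. If a segment of the new
    -- order received `X`, its image would lie in a smaller segment of the old one.
    initial-order : (X : Set) → Σ (WellOrder X) Initial
    initial-order X with em (∃[ d ] (X ≲ Seg (wellOrder X) d))
    ... | inj₂ none = wellOrder X , λ d le → none (d , le)
    ... | inj₁ big with least (wellOrder X) _ big
    ...   | d , X≲Seg@(f , f-inj) , d-min = V , λ y le →
            d-min _ (≲-trans X≲Seg (≲-trans Sub-≲ (≲-trans le (Seg-image y)))) (holds (f y))
      where
      V : WellOrder X
      V = pullback (wellOrder X) (≲-trans X≲Seg Sub-≲)
      Seg-image : ∀ y → Seg V y ≲ Seg (wellOrder X) (proj₁ (f y))
      Seg-image y = (λ s → sub (proj₁ (f (proj₁ s))) (holds s)) ,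
        λ s t eq → Sub-≡ (proj₂ (≲-trans X≲Seg Sub-≲) _ _ (cong proj₁ eq))

  -- If `y` were greatest, the segment below it would be `X` without one point, into which an
  -- infinite `X` still embeds.
  initial-no-max : {X : Set} (W : WellOrder X) → Initial W → ℕ ≲ X → ∀ y → ∃[ z ] WellOrder._<_ W y z
  initial-no-max W init ℕ≲X y = by-contradiction λ none → init y
    (≲-trans (≲-minus-point ℕ≲X y) (Sub-mono λ x x≢y → [ id , (λ y<x → ⊥-elim (none (x , y<x))) ] (≢⇒<⊎> x≢y)))
    where open WellOrder W

  Squarable : Set → Set
  Squarable X = (X × X) ≲ X

  module _ {X : Set} (W : WellOrder X) (init : Initial W) (ℕ≲X : ℕ ≲ X)
           (sq : ∀ y → ℕ ≲ Seg W y → Squarable (Seg W y)) where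

    -- A finite segment has a finite square, and an infinite one absorbs its square by `sq`; neither
    -- can receive `X`.
    segment-product-small : ∀ y → ¬ (X ≲ (Seg W y × Seg W y))
    segment-product-small y le with finite-or-infinite (Seg W y)
    ... | inj₁ fin = ℕ⋠finite (≲-trans ℕ≲X le) (Finite-× fin fin)
    ... | inj₂ inf = init y (≲-trans le (sq y inf))

    private
      open WellOrder W

      _≤_ : X → X → Set
      x ≤ y = x ≡ y ⊎ x < y

      ≤-<-trans : ∀ {x y z} → x ≤ y → y < z → x < z
      ≤-<-trans (inj₁ refl) y<z = y<z
      ≤-<-trans (inj₂ x<y) y<z = <-trans x<y y<z

      max : ∀ ((a , b) : X × X) → Σ X λ m → a ≤ m × b ≤ m
      max (a , b) with <-cmp a b
      ... | tri< a<b _ _ = b , inj₂ a<b , inj₁ refl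
      ... | tri≈ _ a≡b _ = b , inj₁ a≡b , inj₁ refl
      ... | tri> _ _ b<a = a , inj₁ refl , inj₂ b<a

      μ : X × X → X
      μ w = proj₁ (max w)

      -- Pairs with the same maximum are compared by an arbitrary well-order; only a bound on the
      -- set of predecessors matters.
      open WellOrder (wellOrder (X × X)) using () renaming (_<_ to _⊏_; <-wf to ⊏-wf; ≢⇒<⊎> to ≢⇒⊏⊎⊐)

      -- Gödel's ordering of pairs: first by the maximum.
      _≺_ : X × X → X × X → Set
      _≺_ = ×-Lex _≡_ _<_ _⊏_ on λ w → μ w , w

      ≺-wf : WellFounded _≺_
      ≺-wf = on-wellFounded (λ w → μ w , w) (×-wellFounded <-wf ⊏-wf)

      ≢⇒≺⊎≻ : ∀ {v w} → v ≢ w → v ≺ w ⊎ w ≺ v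
      ≢⇒≺⊎≻ {v} {w} v≢w with <-cmp (μ v) (μ w)
      ... | tri< lt _ _ = inj₁ (inj₁ lt)
      ... | tri> _ _ gt = inj₂ (inj₁ gt)
      ... | tri≈ _ eq _ with ≢⇒⊏⊎⊐ v≢w
      ...   | inj₁ lt = inj₁ (inj₂ (eq , lt))
      ...   | inj₂ gt = inj₂ (inj₂ (sym eq , gt))

      ≺⇒≤ : ∀ {v w} → v ≺ w → μ v ≤ μ w
      ≺⇒≤ (inj₁ lt) = inj₂ lt
      ≺⇒≤ (inj₂ (eq , _)) = inj₁ eq

      below-small : ∀ w → ¬ (X ≲ Sub (λ v → v ≺ w))
      below-small w le = segment-product-small z (≲-trans le (into , into-inj))
        where
        -- Predecessors of `w` may have the same maximum as `w`, so a strictly larger bound is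
        -- taken.
        z = proj₁ (initial-no-max W init ℕ≲X (μ w))
        μw<z = proj₂ (initial-no-max W init ℕ≲X (μ w))
        into : Sub (λ v → v ≺ w) → Seg W z × Seg W z
        into s = let ((a , b) , _) = s
                     (_ , a≤m , b≤m) = max (a , b)
                     m<z = ≤-<-trans (≺⇒≤ (holds s)) μw<z
                 in sub a (≤-<-trans a≤m m<z) , sub b (≤-<-trans b≤m m<z)
        into-inj : Injective into
        into-inj s t eq = Sub-≡ (cong₂ _,_ (cong (proj₁ ∘ proj₁) eq) (cong (proj₁ ∘ proj₂) eq))

      Fresh : X × X → (X × X → X) → X → Set
      Fresh w g x = ∀ v → v ≺ w → g v ≢ x

      -- By `below-small` the values at the predecessors of `w` cannot cover `X`, so a new value is
      -- always available.
      pairing : Σ (X × X → X) λ g → ∀ w → Fresh w g (g w)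
      pairing = greedy ≺-wf (proj₁ ℕ≲X 0) Fresh
        (λ w g g′ x agree fr v v≺w eq → fr v v≺w (trans (agree v v≺w) eq))
        λ w g _ → by-contradiction λ none → below-small w (≲-of-cover ((g ∘ proj₁) , λ x →
          let (v , v≺w , eq) = by-contradiction {∃[ v ] (v ≺ w × g v ≡ x)}
                                 λ unhit → none (x , λ v v≺w eq → unhit (v , v≺w , eq))
          in sub v v≺w , eq))

    opaque
      initial-squarable : Squarable X
      initial-squarable = proj₁ pairing , λ v w eq → by-contradiction λ v≢w →
        [ (λ v≺w → proj₂ pairing w v v≺w eq) , (λ w≺v → proj₂ pairing v w w≺v (sym eq)) ] (≢⇒≺⊎≻ v≢w)

  opaque
    -- Either `X` embeds into one of its segments and inherits its pairing, or the order is already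
    -- initial.
    squarable-of-segments : {X : Set} (W : WellOrder X) → ℕ ≲ X →
      (∀ y → ℕ ≲ Seg W y → Squarable (Seg W y)) → Squarable X
    squarable-of-segments {X} W ℕ≲X sq with em (∃[ y ] (X ≲ Seg W y))
    ... | inj₁ (y , le) = ≲-trans (≲-× le le) (≲-trans (sq y (≲-trans ℕ≲X le)) Sub-≲)
    ... | inj₂ none = initial-squarable W (λ y le → none (y , le)) ℕ≲X sq

  opaque
    -- Induction on `d`: a segment of the suborder `Seg W d` is, up to injections both ways, a
    -- segment of `W` below a smaller element.
    segment-squarable : {X : Set} (W : WellOrder X) → ∀ d → ℕ ≲ Seg W d → Squarable (Seg W d)
    segment-squarable {X} W = All.wfRec <-wf 0ℓ (λ d → ℕ ≲ Seg W d → Squarable (Seg W d)) λ d IH inf →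
      let V = pullback W Sub-≲
          up : ∀ s → Seg V s ≲ Seg W (proj₁ s)
          up s = (λ t → sub (proj₁ (proj₁ t)) (holds t)) , λ t u eq → Sub-≡ (Sub-≡ (cong proj₁ eq))
          down : ∀ s → Seg W (proj₁ s) ≲ Seg V s
          down s = (λ t → sub (sub (proj₁ t) (<-trans (holds t) (holds s))) (holds t)) ,
                   λ t u eq → Sub-≡ (cong (proj₁ ∘ proj₁) eq)
      in squarable-of-segments V inf λ s inf′ →
           ≲-trans (≲-× (up s) (up s)) (≲-trans (IH (holds s) (≲-trans inf′ (up s))) (down s))
      where open WellOrder W

  opaque
    infinite-squarable : {X : Set} → ℕ ≲ X → Squarable X
    infinite-squarable {X} ℕ≲X = squarable-of-segments (wellOrder X) ℕ≲X (segment-squarable (wellOrder X))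

  Bool-≲-ℕ : Bool ≲ ℕ
  Bool-≲-ℕ = (λ { false → 0 ; true → 1 }) ,
    λ { false false _ → refl ; false true () ; true false () ; true true _ → refl }

  opaque
    -- Lists are coded by iterated pairing, with the two values `x 0` and `x 1` marking empty and
    -- non-empty lists.
    List-≲ : {X : Set} → ℕ ≲ X → List X ≲ X
    List-≲ {X} ℕ≲X@(x , x-inj) with infinite-squarable ℕ≲X
    ... | pair , pair-inj = code , code-inj
      where
      code : List X → X
      code [] = pair (x 0 , x 0)
      code (a ∷ as) = pair (x 1 , pair (a , code as))
      0≢1 : x 0 ≢ x 1
      0≢1 eq = contradiction (x-inj _ _ eq) λ ()
      code-inj : Injective code
      code-inj [] [] _ = refl
      code-inj [] (b ∷ bs) eq = ⊥-elim (0≢1 (cong proj₁ (pair-inj _ _ eq)))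
      code-inj (a ∷ as) [] eq = ⊥-elim (0≢1 (cong proj₁ (pair-inj _ _ (sym eq))))
      code-inj (a ∷ as) (b ∷ bs) eq =
        let eq′ = pair-inj _ _ (cong proj₂ (pair-inj _ _ eq))
        in cong₂ _∷_ (cong proj₁ eq′) (code-inj as bs (cong proj₂ eq′))

  opaque
    -- The order comes from an initial order of `X`, whose segments stay smaller than `X` when
    -- doubled. The factor `Bool` accounts for the two ends of each edge coloured so far.
    short-order : {X Y : Set} → ℕ ≲ X → Y ≲ X → Σ (WellOrder Y) λ W → ∀ y → ¬ (X ≲ (Bool × Seg W y))
    short-order {X} {Y} ℕ≲X Y≲X@(j , j-inj) with initial-order X
    ... | V , V-init = W , small
      where
      W : WellOrder Y
      W = pullback V Y≲X
      Seg-image : ∀ y → Seg W y ≲ Seg V (j y)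
      Seg-image y = (λ s → sub (j (proj₁ s)) (holds s)) , λ s t eq → Sub-≡ (j-inj _ _ (cong proj₁ eq))
      small : ∀ y → ¬ (X ≲ (Bool × Seg W y))
      small y le with finite-or-infinite (Seg V (j y))
      ... | inj₁ fin = ℕ⋠finite (≲-trans ℕ≲X (≲-trans le (≲-× Bool-≲-2 (Seg-image y)))) (Finite-× (2 , id , λ _ _ eq → eq) fin)
        where
        Bool-≲-2 : Bool ≲ Fin 2
        Bool-≲-2 = (λ { false → zero ; true → suc zero }) ,
          λ { false false _ → refl ; false true () ; true false () ; true true _ → refl }
      ... | inj₂ inf = segment-product-small V V-init ℕ≲X (λ z → segment-squarable V z) (j y)
                         (≲-trans le (≲-× (≲-trans Bool-≲-ℕ inf) (Seg-image y)))

  -- Relations of infinite degree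

  -- nb z enumerates the neighbours of z in a D-regular undirected graph on Z.
  module InfiniteDegree {Z D : Set} (ℕ≲D : ℕ ≲ D) (nb : Z → D → Z) (nb-inj : ∀ z → Injective (nb z))
         (nb-sym : ∀ z d → ∃[ d′ ] nb (nb z d) d′ ≡ z) where

    Adj : Z → Z → Set
    Adj z z′ = ∃[ d ] nb z d ≡ z′

    Adj-sym : ∀ {z z′} → Adj z z′ → Adj z′ z
    Adj-sym (d , refl) = nb-sym _ d

    -- The last list entry is the first step taken. Lists thus enumerate the component of `r`, which
    -- bounds its size by that of `D`.
    reach : Z → List D → Z
    reach r [] = r
    reach r (d ∷ ds) = nb (reach r ds) d

    ColouredEdge : Set
    ColouredEdge = Z × Z × D

    -- Edges are undirected but stored with an orientation; the Boolean tells from which end one is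
    -- read.
    src tgt : Bool → ColouredEdge → Z
    src false (z , _ , _) = z
    src true  (_ , z , _) = z
    tgt false (_ , z , _) = z
    tgt true  (z , _ , _) = z

    col : ColouredEdge → D
    col (_ , _ , c) = c

    opp : Bool → Bool
    opp false = true
    opp true = false

    src-opp : ∀ b e → src (opp b) e ≡ tgt b e
    src-opp false _ = refl
    src-opp true _ = refl

    tgt-opp : ∀ b e → tgt (opp b) e ≡ src b e
    tgt-opp false _ = refl
    tgt-opp true _ = refl

    -- From left to right: at a common end, a colour occurs on one edge only. From right to left: an
    -- edge carries one colour only.
    Compat : ColouredEdge → ColouredEdge → Set
    Compat e e′ = ∀ b b′ → src b e ≡ src b′ e′ → (col e ≡ col e′) ⇔ (tgt b e ≡ tgt b′ e′)

    Compat-refl : ∀ e → Compat e e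
    Compat-refl e false false _ = (λ _ → refl) , (λ _ → refl)
    Compat-refl e false true eq = (λ _ → sym eq) , (λ _ → refl)
    Compat-refl e true false eq = (λ _ → sym eq) , (λ _ → refl)
    Compat-refl e true true _ = (λ _ → refl) , (λ _ → refl)

    Compat-sym : ∀ {e e′} → Compat e e′ → Compat e′ e
    Compat-sym c b b′ eq = let (p , q) = c b′ b (sym eq) in sym ∘ p ∘ sym , sym ∘ q ∘ sym

    -- (true , w , d) asks for an edge of colour d at the vertex reached by w,
    -- (false , w , d) for a colour of the d-th edge at that vertex.
    Task : Set
    Task = Bool × List D × D

    Task-≲ : Task ≲ D
    Task-≲ = ≲-trans (≲-× (≲-trans Bool-≲-ℕ ℕ≲D) (≲-trans (≲-× (List-≲ ℕ≲D) (id , λ _ _ eq → eq)) D²≲D)) D²≲D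
      where D²≲D = infinite-squarable ℕ≲D

    taskOrder = proj₁ (short-order ℕ≲D Task-≲)
    task-short = proj₂ (short-order ℕ≲D Task-≲)
    open WellOrder taskOrder renaming (_<_ to _≺_; <-wf to ≺-wf; <-cmp to ≺-cmp)

    module Component (r : Z) where

      Done : Task → ColouredEdge → Set
      Done (true  , w , d) e = ∃[ b ] (src b e ≡ reach r w × col e ≡ d)
      Done (false , w , d) e = ∃[ b ] (src b e ≡ reach r w × tgt b e ≡ nb (reach r w) d)

      Good : Task → (Task → ColouredEdge) → ColouredEdge → Set
      Good t g e = Adj (src false e) (tgt false e) × Done t e × (∀ v → v ≺ t → Compat (g v) e)

      Good-local : ∀ t g g′ e → (∀ v → v ≺ t → g v ≡ g′ v) → Good t g e → Good t g′ e
      Good-local t g g′ e agree (a , d , c) = a , d , λ v v≺t → subst (λ x → Compat x e) (agree v v≺t) (c v v≺t)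

      compatible : ∀ g u v → Good u g (g u) → Good v g (g v) → Compat (g u) (g v)
      compatible g u v (_ , _ , cu) (_ , _ , cv) with ≺-cmp u v
      ... | tri< u≺v _ _ = cv u u≺v
      ... | tri≈ _ refl _ = Compat-refl (g u)
      ... | tri> _ _ v≺u = Compat-sym {g v} {g u} (cu v v≺u)

      module Extend (g : Task → ColouredEdge) where

        unused-colour : ∀ t → ∃[ c ] (∀ v → v ≺ t → col (g v) ≢ c)
        unused-colour t = by-contradiction λ none →
          let use : ∀ c → ∃[ v ] (v ≺ t × col (g v) ≡ c)
              use c = by-contradiction λ unhit → none (c , λ v v≺t eq → unhit (v , v≺t , eq))
          -- An earlier stage uses a single colour, so the Boolean is padded with `false`.
          in task-short t ((λ c → let (v , v≺t , _) = use c in false , sub v v≺t) , λ c c′ eq →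
               trans (sym (proj₂ (proj₂ (use c))))
                 (trans (cong (col ∘ g ∘ proj₁ ∘ proj₂) eq) (proj₂ (proj₂ (use c′)))))

        -- The stages before `t`, with two ends each, are too few to touch all neighbours of `z`,
        -- which are as many as the elements of `D`.
        unused-neighbour : ∀ t z → ∃[ i ] (∀ v → v ≺ t → ∀ b → src b (g v) ≢ nb z i)
        unused-neighbour t z = by-contradiction λ none →
          let use : ∀ i → ∃[ v ] (v ≺ t × ∃[ b ] src b (g v) ≡ nb z i)
              use i = by-contradiction λ unhit → none (i , λ v v≺t b eq → unhit (v , v≺t , b , eq))
          in task-short t ((λ i → let (v , v≺t , b , _) = use i in b , sub v v≺t) , λ i i′ eq →
               nb-inj z i i′ (trans (sym (proj₂ (proj₂ (proj₂ (use i)))))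
                 (trans (cong (λ (b , s) → src b (g (proj₁ s))) eq) (proj₂ (proj₂ (proj₂ (use i′)))))))

        fresh : ∀ t → (∀ v → v ≺ t → ¬ Done t (g v)) → ∃ (Good t g)
        fresh t@(true , w , c) undone =
          let (i , unused) = unused-neighbour t z
              e = z , nb z i , c
              compat : ∀ v → v ≺ t → Compat (g v) e
              compat v v≺t = λ where
                b false eq → (λ c≡ → ⊥-elim (undone v v≺t (b , eq , c≡))) ,
                  (λ t≡ → ⊥-elim (unused v v≺t (opp b) (trans (src-opp b (g v)) t≡)))
                b true eq → ⊥-elim (unused v v≺t b eq)
          in e , (i , refl) , (false , refl , refl) , compat
          where z = reach r w
        fresh t@(false , w , i) undone =
          let (c , unused) = unused-colour t
              e = z , nb z i , c
              compat : ∀ v → v ≺ t → Compat (g v) e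
              compat v v≺t = λ where
                b false eq → (λ c≡ → ⊥-elim (unused v v≺t c≡)) ,
                  (λ t≡ → ⊥-elim (undone v v≺t (b , eq , t≡)))
                b true eq → (λ c≡ → ⊥-elim (unused v v≺t c≡)) ,
                  (λ t≡ → ⊥-elim (undone v v≺t (opp b , trans (src-opp b (g v)) t≡ , trans (tgt-opp b (g v)) eq)))
          in e , (i , refl) , (false , refl , refl) , compat
          where z = reach r w

        extend : ∀ t → (∀ v → v ≺ t → Good v g (g v)) → ∃ (Good t g)
        extend t good with em (∃[ v ] (v ≺ t × Done t (g v)))
        -- The edge of the earlier stage is repeated; it is compatible with itself and with all
        -- others.
        ... | inj₁ (v , v≺t , done) = g v , proj₁ (good v v≺t) , done ,
                λ u u≺t → compatible g u v (good u u≺t) (good v v≺t)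
        ... | inj₂ none = fresh t λ v v≺t done → none (v , v≺t , done)

      opaque
        colouring : Σ (Task → ColouredEdge) λ g → ∀ t → Good t g (g t)
        colouring = greedy ≺-wf (r , r , proj₁ ℕ≲D 0) Good Good-local λ t g → Extend.extend g t

      g = proj₁ colouring
      good = proj₂ colouring

      Coloured : Z → Z → D → Set
      Coloured z z′ c = ∃[ t ] ∃[ b ] (src b (g t) ≡ z × tgt b (g t) ≡ z′ × col (g t) ≡ c)

      Coloured-sym : ∀ {z z′ c} → Coloured z z′ c → Coloured z′ z c
      Coloured-sym (t , b , p , q , s) = t , opp b , trans (src-opp b (g t)) q , trans (tgt-opp b (g t)) p , s

      Coloured⇒Adj : ∀ {z z′ c} → Coloured z z′ c → Adj z z′
      Coloured⇒Adj (t , false , refl , refl , _) = proj₁ (good t)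
      Coloured⇒Adj (t , true , refl , refl , _) = Adj-sym (proj₁ (good t))

      Coloured-target : ∀ {z z′ z″ c} → Coloured z z′ c → Coloured z z″ c → z′ ≡ z″
      Coloured-target (t , b , p , q , s) (t′ , b′ , p′ , q′ , s′) =
        trans (sym q) (trans (proj₁ (compatible g t t′ (good t) (good t′) b b′ (trans p (sym p′))) (trans s (sym s′))) q′)

      Coloured-colour : ∀ {z z′ c c′} → Coloured z z′ c → Coloured z z′ c′ → c ≡ c′
      Coloured-colour (t , b , p , q , s) (t′ , b′ , p′ , q′ , s′) =
        trans (sym s) (trans (proj₂ (compatible g t t′ (good t) (good t′) b b′ (trans p (sym p′))) (trans q (sym q′))) s′)

      every-colour : ∀ w c → ∃[ z ] Coloured (reach r w) z c
      every-colour w c = let (b , p , s) = proj₁ (proj₂ (good t)) in tgt b (g t) , t , b , p , refl , s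
        where t = true , w , c

      every-edge : ∀ w i → ∃[ c ] Coloured (reach r w) (nb (reach r w) i) c
      every-edge w i = let (b , p , q) = proj₁ (proj₂ (good t)) in col (g t) , t , b , p , q , refl
        where t = false , w , i

    open Component using (Coloured; Coloured-sym; Coloured⇒Adj; Coloured-target; Coloured-colour; every-colour; every-edge)

    Reaches : Z → Z → Set
    Reaches z r = ∃[ w ] reach r w ≡ z

    opaque
      root-least : ∀ z → ∃ (WellOrder.Least (wellOrder Z) (Reaches z))
      root-least z = least (wellOrder Z) (Reaches z) (z , [] , refl)

    -- A canonical representative of the component of `z`: adjacent vertices are reached from the
    -- same vertices, so they share the least one and hence one colouring.
    root : Z → Z
    root z = proj₁ (root-least z)

    root-reaches : ∀ z → Reaches z (root z)
    root-reaches z = proj₁ (proj₂ (root-least z))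

    Reaches-Adj : ∀ {z z′} → Adj z z′ → ∀ r → Reaches z r → Reaches z′ r
    Reaches-Adj (d , refl) r (w , refl) = d ∷ w , refl

    root-Adj : ∀ {z z′} → Adj z z′ → root z ≡ root z′
    root-Adj {z} {z′} a = WellOrder.Least-unique (wellOrder Z)
      (λ r → Reaches-Adj a r , Reaches-Adj (Adj-sym a) r) (proj₂ (root-least z)) (proj₂ (root-least z′))

    opaque
      next : ∀ z c → ∃[ z′ ] Coloured (root z) z z′ c
      next z c = let (w , eq) = root-reaches z in
        subst (λ x → ∃[ z′ ] Coloured (root z) x z′ c) eq (every-colour (root z) w c)

    factor : D → Z → Z
    factor c z = proj₁ (next z c)

    factor-Adj : ∀ c z → Adj z (factor c z)
    factor-Adj c z = Coloured⇒Adj (root z) (proj₂ (next z c))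

    factor-unique : ∀ {c z z′} → Coloured (root z) z z′ c → factor c z ≡ z′
    factor-unique {c} {z} cd = Coloured-target (root z) (proj₂ (next z c)) cd

    -- The edge of colour `c` at the far end is the same edge read backwards, since both ends use
    -- the colouring of one root.
    factor-involutive : ∀ c z → factor c (factor c z) ≡ z
    factor-involutive c z = factor-unique
      (subst (λ r → Coloured r (factor c z) z c) (root-Adj (factor-Adj c z)) (Coloured-sym (root z) (proj₂ (next z c))))

    factor-distinct : ∀ c d z → factor c z ≡ factor d z → c ≡ d
    factor-distinct c d z eq = Coloured-colour (root z) (proj₂ (next z c))
      (subst (λ x → Coloured (root z) z x d) (sym eq) (proj₂ (next z d)))

    factor-covering : ∀ z i → ∃[ c ] factor c z ≡ nb z i
    factor-covering z i =
      let (w , eq) = root-reaches z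
          (c , cd) = subst (λ x → ∃[ c ] Coloured (root z) x (nb x i) c) eq (every-edge (root z) w i)
      in c , factor-unique cd

  -- On the disjoint union of `X` and `Y` every colour gives an involution that exchanges the two
  -- sides, hence a bijection from `X` to `Y`.
  infinite-factorization : {X Y : Set} {R : X → Y → Set} {D : Set} → ℕ ≲ D → Regular R D → Factorization R D
  infinite-factorization {X} {Y} {R} {D} ℕ≲D (out , inn) = record
    { factor = λ d → record
      { fun = fun d
      ; edge = λ x → proj₂ (out-img x (fun d x)) (proj₁ (factor-Adj d (inj₁ x)) , refl)
      ; injective = λ x x′ eq → inj₁-injective (trans (sym (factor-involutive d (inj₁ x)))
          (trans (cong (factor d) (trans (factor-fun d x) (trans (cong inj₂ eq) (sym (factor-fun d x′)))))
            (factor-involutive d (inj₁ x′))))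
      ; surjective = onto d
      }
    ; distinct = λ c d x eq → factor-distinct c d (inj₁ x)
        (trans (factor-fun c x) (trans (cong inj₂ eq) (sym (factor-fun d x))))
    ; covering = λ x y Rxy →
        let (i , eq) = proj₁ (out-img x y) Rxy
            (c , eq′) = factor-covering (inj₁ x) i
        in c , trans (inj₂-injective (trans (sym (factor-fun c x)) eq′)) eq
    }
    where
    out-nb : X → D → Y
    out-nb x = proj₁ (out x)
    in-nb : Y → D → X
    in-nb y = proj₁ (inn y)
    out-img = λ x → proj₂ (proj₂ (out x))
    in-img = λ y → proj₂ (proj₂ (inn y))

    nb : X ⊎ Y → D → X ⊎ Y
    nb (inj₁ x) d = inj₂ (out-nb x d)
    nb (inj₂ y) d = inj₁ (in-nb y d)

    nb-inj : ∀ z → Injective (nb z)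
    nb-inj (inj₁ x) c d eq = proj₁ (proj₂ (out x)) c d (inj₂-injective eq)
    nb-inj (inj₂ y) c d eq = proj₁ (proj₂ (inn y)) c d (inj₁-injective eq)

    nb-sym : ∀ z d → ∃[ d′ ] nb (nb z d) d′ ≡ z
    nb-sym (inj₁ x) d =
      let (d′ , eq) = proj₁ (in-img _ x) (proj₂ (out-img x _) (d , refl)) in d′ , cong inj₁ eq
    nb-sym (inj₂ y) d =
      let (d′ , eq) = proj₁ (out-img _ y) (proj₂ (in-img y _) (d , refl)) in d′ , cong inj₂ eq

    open InfiniteDegree ℕ≲D nb nb-inj nb-sym

    fun : D → X → Y
    fun d x = out-nb x (proj₁ (factor-Adj d (inj₁ x)))

    factor-fun : ∀ d x → factor d (inj₁ x) ≡ inj₂ (fun d x)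
    factor-fun d x = sym (proj₂ (factor-Adj d (inj₁ x)))

    onto : ∀ d y → ∃[ x ] fun d x ≡ y
    onto d y = let (i , eq) = factor-Adj d (inj₂ y) in in-nb y i ,
      inj₂-injective (trans (sym (factor-fun d (in-nb y i)))
        (trans (cong (factor d) eq) (factor-involutive d (inj₂ y))))

  -- Relations of finite degree

  ≲-Fin-remove : ∀ {X n} → X ≲ Fin (suc n) → ∀ x₀ → Sub (λ x → x ≢ x₀) ≲ Fin n
  ≲-Fin-remove (f , f-inj) x₀ = (λ s → punchOut (ne s)) ,
    λ s t eq → Sub-≡ (f-inj _ _ (punchOut-injective (ne s) (ne t) eq))
    where
    ne : ∀ (s : Sub (λ x → x ≢ x₀)) → f x₀ ≢ f (proj₁ s)
    ne s eq = holds s (sym (f-inj _ _ eq))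

  listing : {X : Set} → Finite X → Σ (List X) λ xs → ∀ x → x ∈ xs
  listing (n , le) = go n le
    where
    go : ∀ {X} n → X ≲ Fin n → Σ (List X) λ xs → ∀ x → x ∈ xs
    go {X} n le with em X
    ... | inj₂ empty = [] , λ x → ⊥-elim (empty x)
    go zero (f , _) | inj₁ x₀ = contradiction (f x₀) λ ()
    go (suc n) le | inj₁ x₀ with go n (≲-Fin-remove le x₀)
    ... | xs , all = x₀ ∷ map proj₁ xs , member
      where
      member : ∀ x → x ∈ x₀ ∷ map proj₁ xs
      member x with em (x ≡ x₀)
      ... | inj₁ eq = here eq
      ... | inj₂ ne = there (∈-map⁺ proj₁ (all (sub x ne)))

  update : {X Y : Set} → (X → Y) → X → Y → X → Y
  update f a b x with em (x ≡ a)
  ... | inj₁ _ = b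
  ... | inj₂ _ = f x

  update-here : {X Y : Set} (f : X → Y) (a : X) (b : Y) → ∀ {x} → x ≡ a → update f a b x ≡ b
  update-here f a b {x} eq with em (x ≡ a)
  ... | inj₁ _ = refl
  ... | inj₂ ne = ⊥-elim (ne eq)

  update-there : {X Y : Set} (f : X → Y) (a : X) (b : Y) → ∀ {x} → x ≢ a → update f a b x ≡ f x
  update-there f a b {x} ne with em (x ≡ a)
  ... | inj₁ eq = ⊥-elim (ne eq)
  ... | inj₂ _ = refl

  -- `m` is a total function of which only the values on `A` count, so that restriction needs no
  -- change of `m`.
  Matches : {X Y : Set} → (X → Y → Set) → List X → (X → Y) → Set
  Matches R A m = (∀ x → x ∈ A → R x (m x)) × (∀ x x′ → x ∈ A → x′ ∈ A → m x ≡ m x′ → x ≡ x′)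

  Matches-⊆ : {X Y : Set} {R : X → Y → Set} {A B : List X} {m : X → Y} →
    (∀ x → x ∈ A → x ∈ B) → Matches R B m → Matches R A m
  Matches-⊆ A⊆B (e , i) = (λ x x∈A → e x (A⊆B x x∈A)) , λ x x′ p q → i x x′ (A⊆B x p) (A⊆B x′ q)

  module _ {X Y : Set} (R : X → Y → Set) (A : List X) where

    -- Covers both giving a vertex of `A` a new partner and adding a vertex to `A`.
    Matches-update : ∀ {m B} l y → (∀ x → x ∈ B → x ≢ l → x ∈ A) → Matches R A m → R l y →
      (∀ a → a ∈ A → m a ≢ y) → Matches R B (update m l y)
    Matches-update {m} {B} l y B⊆A (edge , inj) Rly free = edge′ , inj′
      where
      at : ∀ x → (x ≡ l × update m l y x ≡ y) ⊎ (x ≢ l × update m l y x ≡ m x)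
      at x with em (x ≡ l)
      ... | inj₁ eq = inj₁ (eq , refl)
      ... | inj₂ ne = inj₂ (ne , refl)
      edge′ : ∀ x → x ∈ B → R x (update m l y x)
      edge′ x x∈B with at x
      ... | inj₁ (refl , eq) = subst (R x) (sym eq) Rly
      ... | inj₂ (ne , eq) = subst (R x) (sym eq) (edge x (B⊆A x x∈B ne))
      inj′ : ∀ x x′ → x ∈ B → x′ ∈ B → update m l y x ≡ update m l y x′ → x ≡ x′
      inj′ x x′ p q eq with at x | at x′
      ... | inj₁ (u , _) | inj₁ (v , _) = trans u (sym v)
      ... | inj₁ (_ , u) | inj₂ (ne , v) = ⊥-elim (free x′ (B⊆A x′ q ne) (trans (sym v) (trans (sym eq) u)))
      ... | inj₂ (ne , u) | inj₁ (_ , v) = ⊥-elim (free x (B⊆A x p ne) (trans (sym u) (trans eq v)))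
      ... | inj₂ (ne , u) | inj₂ (ne′ , v) = inj x x′ (B⊆A x p ne) (B⊆A x′ q ne′) (trans (sym u) (trans eq v))

    module _ (x : X) where

      -- Simple alternating paths from x to l; the list holds the earlier left vertices.
      data Path (m : X → Y) : X → List X → Set where
        start : Path m x []
        step  : ∀ {l vs l′} → Path m l vs → R l (m l′) → l′ ∈ A → l′ ∉ l ∷ vs → Path m l′ (l ∷ vs)

      Path-cong : ∀ {m m′ l vs} → (∀ v → v ∈ l ∷ vs → m v ≡ m′ v) → Path m l vs → Path m′ l vs
      Path-cong eq start = start
      Path-cong eq (step {l} p r l′∈A l′∉) =
        step (Path-cong (λ v v∈ → eq v (there v∈)) p) (subst (R l) (eq _ (here refl)) r) l′∈A l′∉

      Path-prefix : ∀ {m l vs v} → Path m l vs → v ∈ l ∷ vs → ∃[ us ] Path m v us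
      Path-prefix p (here refl) = _ , p
      Path-prefix (step p _ _ _) (there v∈) = Path-prefix p v∈

      -- Flip the path from its far end: matching `l` with the free `y` releases `m l`, which is
      -- adjacent to the previous vertex of the path.
      augment : ∀ vs {m l y} → Matches R A m → Path m l vs → R l y → (∀ a → a ∈ A → m a ≢ y) →
        ∃ (Matches R (x ∷ A))
      augment [] {m} {_} {y} M start Rly free = update m x y ,
        Matches-update x y (λ { _ (here eq) ne → ⊥-elim (ne eq) ; _ (there z∈A) _ → z∈A }) M Rly free
      augment (l₀ ∷ vs) {m} {l} {y} M (step p r l∈A l∉) Rly free =
        augment vs {update m l y} (Matches-update l y (λ _ z∈A _ → z∈A) M Rly free)
          -- The path is simple, so the update at `l` does not affect what remains of it.
          (Path-cong (λ v v∈ → sym (update-there m l y λ { refl → l∉ v∈ })) p) r free′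
        where
        free′ : ∀ a → a ∈ A → update m l y a ≢ m l
        free′ a a∈A eq with em (a ≡ l)
        ... | inj₁ a≡l = free l l∈A (sym eq)
        ... | inj₂ a≢l = a≢l (proj₂ M a l a∈A l∈A eq)

  module _ {X Y D : Set} {R : X → Y → Set} (d₀ : D) (fin : Finite D) (reg : Regular R D) where

    private
      out : X → D → Y
      out x = proj₁ (proj₁ reg x)

      out-inj : ∀ x → Injective (out x)
      out-inj x = proj₁ (proj₂ (proj₁ reg x))

      out-edge : ∀ x d → R x (out x d)
      out-edge x d = proj₂ (proj₂ (proj₂ (proj₁ reg x)) _) (d , refl)

      out-index : ∀ {x y} → R x y → ∃[ d ] out x d ≡ y
      out-index r = proj₁ (proj₂ (proj₂ (proj₁ reg _)) _) r

      in-index : ∀ {x y} → R x y → ∃[ d ] proj₁ (proj₂ reg y) d ≡ x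
      in-index {x} {y} r = proj₁ (proj₂ (proj₂ (proj₂ reg y)) x) r

    -- If no alternating path from x reaches an unmatched vertex, then following an edge out of the
    -- set L of reachable vertices and returning along the matching is an injection of the finite
    -- set L × D into itself that misses x.
    augmentable : ∀ x A m → x ∉ A → Matches R A m →
      ∃[ l ] ∃[ vs ] ∃[ y ] (Path R A x m l vs × R l y × (∀ a → a ∈ A → m a ≢ y))
    augmentable x A m x∉A M = by-contradiction λ stuck →
      let return : ∀ (s : Sub L) d → ∃[ a ] (a ∈ A × L a × m a ≡ out (proj₁ s) d)
          return s d =
            let l = proj₁ s
                (vs , p) = holds s
                (a , a∈A , eq) = by-contradiction {∃[ a ] (a ∈ A × m a ≡ out l d)} λ unmatched →
                  stuck (l , vs , out l d , p , out-edge l d , λ a a∈A eq → unmatched (a , a∈A , eq))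
            in a , a∈A , reachable p a∈A (subst (R l) (sym eq) (out-edge l d)) , eq
          h : Sub L × D → Sub L × D
          -- The second component is the index of the edge as seen from its right end. The matching
          -- recovers that end from the first component, so the two determine the edge.
          h (s , d) = sub (proj₁ (return s d)) (proj₁ (proj₂ (proj₂ (return s d)))) ,
                      proj₁ (in-index (out-edge (proj₁ s) d))
          h-inj : Injective h
          h-inj (s , d) (t , e) eq =
            let (a , _ , _ , p) = return s d
                (b , _ , _ , q) = return t e
            in same-edge s t d e (trans (sym p) (trans (cong (m ∘ proj₁ ∘ proj₁) eq) q)) (cong proj₂ eq)
          h-miss : ∀ s → h s ≢ (sub x ([] , start) , d₀)
          h-miss (s , d) eq = x∉A (subst (_∈ A) (cong (proj₁ ∘ proj₁) eq) (proj₁ (proj₂ (return s d))))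
      in ℕ⋠finite (ℕ-≲-orbit h h-inj _ h-miss) (Finite-× L-finite fin)
      where
      L : X → Set
      L l = ∃[ vs ] Path R A x m l vs

      -- If `a` already lies on the path, a prefix is taken instead, so that paths stay simple.
      reachable : ∀ {l a vs} → Path R A x m l vs → a ∈ A → R l (m a) → L a
      reachable {l} {a} {vs} p a∈A r with em (a ∈ l ∷ vs)
      ... | inj₁ a∈ = Path-prefix R A x p a∈
      ... | inj₂ a∉ = _ , step p r a∈A a∉

      L⊆ : ∀ {l} → L l → l ∈ x ∷ A
      L⊆ (_ , start) = here refl
      L⊆ (_ , step _ _ l∈A _) = there l∈A

      L-finite : Finite (Sub L)
      L-finite = length (x ∷ A) , (λ s → index (L⊆ (holds s))) ,
        λ s t eq → Sub-≡ (Membership.index-injective (setoid X) (L⊆ (holds s)) (L⊆ (holds t)) eq)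

      same-edge : ∀ (s t : Sub L) d e → out (proj₁ s) d ≡ out (proj₁ t) e →
        proj₁ (in-index (out-edge (proj₁ s) d)) ≡ proj₁ (in-index (out-edge (proj₁ t) e)) → (s , d) ≡ (t , e)
      same-edge s t d e eq eq′ = pairs (Sub-≡ {s = s} {t = t} l≡) eq
        where
        l≡ : proj₁ s ≡ proj₁ t
        l≡ = trans (sym (proj₂ (in-index (out-edge (proj₁ s) d))))
               (trans (cong₂ (λ y → proj₁ (proj₂ reg y)) eq eq′) (proj₂ (in-index (out-edge (proj₁ t) e))))
        pairs : s ≡ t → out (proj₁ s) d ≡ out (proj₁ t) e → (s , d) ≡ (t , e)
        pairs refl eq = cong (s ,_) (out-inj _ _ _ eq)

    finite-matching : ∀ A → ∃ (Matches R A)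
    finite-matching [] = (λ x → out x d₀) , (λ _ ()) , (λ _ _ ())
    finite-matching (x ∷ A) with finite-matching A | em (x ∈ A)
    ... | m , M | inj₁ x∈A = m , Matches-⊆ {R = R} (λ { _ (here refl) → x∈A ; _ (there z∈A) → z∈A }) M
    ... | m , M | inj₂ x∉A =
      let (l , vs , y , p , r , free) = augmentable x A m x∉A M in augment R A x vs M p r free

    private
      open WellOrder (wellOrder X)

      -- The invariant of the transfinite choice of f: a finite set only meets finitely many
      -- stages, so that extendability to all finite sets survives limit stages.
      Good : X → (X → Y) → Y → Set
      Good x f y = ∀ A → ∃[ m ] (Matches R A m × (x ∈ A → m x ≡ y) × (∀ z → z ∈ A → z < x → m z ≡ f z))

      Good-local : ∀ x f f′ y → (∀ z → z < x → f z ≡ f′ z) → Good x f y → Good x f′ y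
      Good-local x f f′ y agree good A = let (m , M , p , q) = good A in
        m , M , p , λ z z∈A z<x → trans (q z z∈A z<x) (agree z z<x)

      LastBelow : X → List X → X → Set
      LastBelow x A z = z ∈ A × z < x × (∀ z′ → z′ ∈ A → z′ < x → z′ ≡ z ⊎ z′ < z)

      last-below : ∀ x A → (∀ z → z ∈ A → ¬ z < x) ⊎ ∃ (LastBelow x A)
      last-below x [] = inj₁ λ _ ()
      last-below x (a ∷ A) with last-below x A | em (a < x)
      ... | inj₁ none | inj₂ a≮x = inj₁ λ { _ (here refl) → a≮x ; z (there z∈A) → none z z∈A }
      ... | inj₁ none | inj₁ a<x = inj₂ (a , here refl , a<x , λ
              { _ (here eq) _ → inj₁ eq ; z (there z∈A) z<x → ⊥-elim (none z z∈A z<x) })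
      ... | inj₂ (z , z∈A , z<x , last) | inj₂ a≮x = inj₂ (z , there z∈A , z<x , λ
              { _ (here refl) a<x → ⊥-elim (a≮x a<x) ; w (there w∈A) → last w w∈A })
      ... | inj₂ (z , z∈A , z<x , last) | inj₁ a<x with <-cmp a z
      ...   | tri< a<z _ _ = inj₂ (z , there z∈A , z<x , λ
                { _ (here refl) _ → inj₂ a<z ; w (there w∈A) → last w w∈A })
      ...   | tri≈ _ a≡z _ = inj₂ (z , there z∈A , z<x , λ
                { _ (here refl) _ → inj₁ a≡z ; w (there w∈A) → last w w∈A })
      ...   | tri> _ _ z<a = inj₂ (a , here refl , a<x , λ
                { _ (here eq) _ → inj₁ eq
                ; w (there w∈A) w<x → inj₂ ([ (λ { refl → z<a }) , (λ w<z → <-trans w<z z<a) ] (last w w∈A w<x)) })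

      -- Only the last stage below `x` that belongs to `A` has to be consulted: its matching already
      -- agrees with `f` at the earlier ones.
      extending : ∀ x f → (∀ z → z < x → Good z f (f z)) →
        ∀ A → ∃[ m ] (Matches R A m × (∀ z → z ∈ A → z < x → m z ≡ f z))
      extending x f good A with last-below x A
      ... | inj₁ none = let (m , M) = finite-matching A in m , M , λ z z∈A z<x → ⊥-elim (none z z∈A z<x)
      ... | inj₂ (z , z∈A , z<x , last) =
        let (m , M , p , q) = good z z<x A in
        m , M , λ w w∈A w<x → [ (λ { refl → p w∈A }) , q w w∈A ] (last w w∈A w<x)

      -- Compactness: if each of the finitely many neighbours of `x` failed on some finite list, a
      -- matching on the union of these lists and `x` would give `x` one of these neighbours, which
      -- then does not fail.
      extend : ∀ x f → (∀ z → z < x → Good z f (f z)) → ∃ (Good x f)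
      extend x f good = by-contradiction λ none →
        let Works : D → List X → (X → Y) → Set
            Works d A m = Matches R A m × (x ∈ A → m x ≡ out x d) × (∀ z → z ∈ A → z < x → m z ≡ f z)
            bad : ∀ d → Σ (List X) λ A → ¬ ∃ (Works d A)
            bad d = by-contradiction λ ok → none (out x d , λ A → by-contradiction λ fails → ok (A , fails))
            (ds , all) = listing fin
            B = x ∷ concat (map (proj₁ ∘ bad) ds)
            (m , M , q) = extending x f good B
            (d , eq) = out-index (proj₁ M x (here refl))
            ⊆B : ∀ z → z ∈ proj₁ (bad d) → z ∈ B
            ⊆B z z∈ = there (∈-concat⁺′ z∈ (∈-map⁺ (proj₁ ∘ bad) (all d)))
        in proj₂ (bad d) (m , Matches-⊆ {R = R} ⊆B M , (λ _ → sym eq) , λ z z∈ → q z (⊆B z z∈))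

    -- Being an edge concerns one vertex and injectivity two, so `Good` on lists of length one and
    -- two suffices.
    left-matching : Σ (X → Y) λ f → (∀ x → R x (f x)) × Injective f
    left-matching with em X
    ... | inj₂ empty = (λ x → ⊥-elim (empty x)) , (λ x → ⊥-elim (empty x)) , λ x → ⊥-elim (empty x)
    ... | inj₁ x₀ with greedy <-wf (out x₀ d₀) Good Good-local extend
    ...   | f , good = f , edge , inj
      where
      edge : ∀ x → R x (f x)
      edge x = let (m , M , p , _) = good x (x ∷ []) in
        subst (R x) (p (here refl)) (proj₁ M x (here refl))

      inj< : ∀ x x′ → x < x′ → f x ≢ f x′
      inj< x x′ x<x′ eq =
        let (m , M , p , q) = good x′ (x ∷ x′ ∷ [])
            mx = q x (here refl) x<x′
            mx′ = p (there (here refl))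
            x≡x′ = proj₂ M x x′ (here refl) (there (here refl)) (trans mx (trans eq (sym mx′)))
        in <-irrefl (subst (_< x′) x≡x′ x<x′)

      inj : Injective f
      inj x x′ eq = by-contradiction λ ne → [ (λ lt → inj< x x′ lt eq) , (λ gt → inj< x′ x gt (sym eq)) ] (≢⇒<⊎> ne)

  -- Cantor-Schröder-Bernstein along a relation.

  module _ {X Y : Set} {R : X → Y → Set} (f : X → Y) (g : Y → X) (f-inj : Injective f) (g-inj : Injective g)
           (f-edge : ∀ x → R x (f x)) (g-edge : ∀ y → R (g y) y) where

    private
      -- The points that trace back through `g` and `f` to a point outside the range of `g`. There
      -- `f` is used, and elsewhere the inverse of `g`.
      data Chain : X → Set where
        base : ∀ {x} → (∀ y → g y ≢ x) → Chain x
        step : ∀ {x x′} → Chain x → g (f x) ≡ x′ → Chain x′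

      Image : X → Y → Set
      Image x y = (Chain x × y ≡ f x) ⊎ (¬ Chain x × g y ≡ x)

      image : ∀ x → ∃ (Image x)
      image x with em (Chain x)
      ... | inj₁ c = f x , inj₁ (c , refl)
      ... | inj₂ ¬c = let (y , eq) = by-contradiction λ none → ¬c (base λ y eq → none (y , eq)) in y , inj₂ (¬c , eq)

      image-edge : ∀ {x y} → Image x y → R x y
      image-edge (inj₁ (_ , refl)) = f-edge _
      image-edge (inj₂ (_ , refl)) = g-edge _

      image-inj : ∀ {x x′ y} → Image x y → Image x′ y → x ≡ x′
      image-inj (inj₁ (_ , refl)) (inj₁ (_ , eq)) = f-inj _ _ eq
      image-inj (inj₁ (c , refl)) (inj₂ (¬c , eq)) = ⊥-elim (¬c (step c eq))
      image-inj (inj₂ (¬c , eq)) (inj₁ (c , refl)) = ⊥-elim (¬c (step c eq))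
      image-inj (inj₂ (_ , eq)) (inj₂ (_ , eq′)) = trans (sym eq) eq′

      image-functional : ∀ {x y y′} → Image x y → Image x y′ → y ≡ y′
      image-functional (inj₁ (_ , eq)) (inj₁ (_ , eq′)) = trans eq (sym eq′)
      image-functional (inj₁ (c , _)) (inj₂ (¬c , _)) = ⊥-elim (¬c c)
      image-functional (inj₂ (¬c , _)) (inj₁ (c , _)) = ⊥-elim (¬c c)
      image-functional (inj₂ (_ , eq)) (inj₂ (_ , eq′)) = g-inj _ _ (trans eq (sym eq′))

      image-onto : ∀ y → ∃[ x ] Image x y
      image-onto y with em (Chain (g y))
      ... | inj₁ (base none) = ⊥-elim (none y refl)
      ... | inj₁ (step {x} c eq) = x , inj₁ (c , sym (g-inj _ _ eq))
      ... | inj₂ ¬c = g y , inj₂ (¬c , refl)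

    schröder-bernstein : PerfectMatching R
    schröder-bernstein = record
      { fun = λ x → proj₁ (image x)
      ; edge = λ x → image-edge (proj₂ (image x))
      ; injective = λ x x′ eq → image-inj (proj₂ (image x)) (subst (Image x′) (sym eq) (proj₂ (image x′)))
      ; surjective = λ y → let (x , i) = image-onto y in x , image-functional (proj₂ (image x)) i
      }

  finite-regular-matching : {X Y D : Set} {R : X → Y → Set} → D → Finite D → Regular R D → PerfectMatching R
  finite-regular-matching d₀ fin reg@(out , inn) =
    let (f , f-edge , f-inj) = left-matching d₀ fin reg
        (g , g-edge , g-inj) = left-matching d₀ fin (inn , out)
    in schröder-bernstein f g f-inj g-inj f-edge g-edge

  -- Factorizations assembled from matchings.

  -- The dropped index `d₀` is independent of `y₀`, so that all neighbourhoods remain enumerated by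
  -- one common type.
  Enum-remove : {Y D : Set} {P : Y → Set} → Enum P D → (d₀ : D) → ∀ y₀ → P y₀ →
    Enum (λ y → P y × y ≢ y₀) (Sub λ d → d ≢ d₀)
  Enum-remove {Y} {D} {P} (f , f-inj , f-img) d₀ y₀ Py₀ with proj₁ (f-img y₀) Py₀
  ... | d₁ , refl = f′ ∘ proj₁ , inj , img
    where
    f′ : D → Y
    f′ = update f d₁ (f d₀)

    inj : Injective (f′ ∘ proj₁)
    inj s@(c , _) t@(d , _) eq with em (c ≡ d₁) | em (d ≡ d₁)
    ... | inj₁ p | inj₁ q = Sub-≡ (trans p (sym q))
    ... | inj₁ p | inj₂ q = ⊥-elim (holds t (sym (f-inj _ _ eq)))
    ... | inj₂ p | inj₁ q = ⊥-elim (holds s (f-inj _ _ eq))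
    ... | inj₂ p | inj₂ q = Sub-≡ (f-inj _ _ eq)

    fwd : ∀ y → P y × y ≢ f d₁ → ∃[ s ] f′ (proj₁ s) ≡ y
    fwd y (Py , y≢) with proj₁ (f-img y) Py
    ... | d , refl with em (d ≡ d₀)
    ...   | inj₁ refl = sub d₁ (λ { refl → y≢ refl }) , update-here f d₁ (f d₀) refl
    ...   | inj₂ d≢d₀ = sub d d≢d₀ , update-there f d₁ (f d₀) λ { refl → y≢ refl }

    bwd : ∀ y → ∃[ s ] f′ (proj₁ s) ≡ y → P y × y ≢ f d₁
    bwd _ (s@(d , _) , refl) with em (d ≡ d₁)
    ... | inj₁ refl = proj₂ (f-img _) (d₀ , refl) , λ eq → holds s (sym (f-inj _ _ eq))
    ... | inj₂ d≢d₁ = proj₂ (f-img _) (d , refl) , λ eq → d≢d₁ (f-inj _ _ eq)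

    img : ∀ y → (P y × y ≢ f d₁) ⇔ (∃[ s ] f′ (proj₁ s) ≡ y)
    img y = fwd y , bwd y

  module _ {X Y D : Set} {R : X → Y → Set} (d₀ : D) (h : PerfectMatching R) where

    private module h = PerfectMatching h

    Removed : X → Y → Set
    Removed x y = R x y × y ≢ h.fun x

    Regular-remove : Regular R D → Regular Removed (Sub λ d → d ≢ d₀)
    Regular-remove (out , inn) = (λ x → Enum-remove (out x) d₀ (h.fun x) (h.edge x)) , inn′
      where
      inn′ : ∀ y → Enum (λ x → Removed x y) (Sub λ d → d ≢ d₀)
      inn′ y with h.surjective y
      ... | x₀ , refl = Enum-cong (λ x →
              (λ (r , x≢x₀) → r , λ eq → x≢x₀ (sym (h.injective _ _ eq))) ,
              (λ (r , ne) → r , λ { refl → ne refl }))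
            (Enum-remove (inn y) d₀ x₀ (h.edge x₀))

    module _ (F : Factorization Removed (Sub λ d → d ≢ d₀)) where

      private
        module F = Factorization F

        factor : D → PerfectMatching R
        factor d with em (d ≡ d₀)
        ... | inj₁ _ = h
        ... | inj₂ ne = record
          { fun = F.fun (sub d ne)
          ; edge = proj₁ ∘ F.edge (sub d ne)
          ; injective = F.injective (sub d ne)
          ; surjective = F.surjective (sub d ne)
          }

        fun : D → X → Y
        fun d = PerfectMatching.fun (factor d)

        distinct : ∀ c d x → fun c x ≡ fun d x → c ≡ d
        distinct c d x eq with em (c ≡ d₀) | em (d ≡ d₀)
        ... | inj₁ p | inj₁ q = trans p (sym q)
        ... | inj₁ _ | inj₂ q = ⊥-elim (proj₂ (F.edge (sub d q) x) (sym eq))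
        ... | inj₂ p | inj₁ _ = ⊥-elim (proj₂ (F.edge (sub c p) x) eq)
        ... | inj₂ p | inj₂ q = cong proj₁ (F.distinct (sub c p) (sub d q) x eq)

        factor-d₀ : ∀ x → fun d₀ x ≡ h.fun x
        factor-d₀ x with em (d₀ ≡ d₀)
        ... | inj₁ _ = refl
        ... | inj₂ ne = ⊥-elim (ne refl)

        factor-sub : ∀ s x → fun (proj₁ s) x ≡ F.fun s x
        factor-sub s@(d , _) x with em (d ≡ d₀)
        ... | inj₁ eq = ⊥-elim (holds s eq)
        ... | inj₂ ne = cong (λ t → F.fun t x) (Sub-≡ refl)

        covering : ∀ x y → R x y → ∃[ d ] fun d x ≡ y
        covering x y r with em (y ≡ h.fun x)
        ... | inj₁ refl = d₀ , factor-d₀ x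
        ... | inj₂ ne = let (s , eq) = F.covering x y (r , ne) in proj₁ s , trans (factor-sub s x) eq

      -- The second component remembers which colour the removed matching received; with the
      -- diagonal as matching, that colour acts as the identity.
      Factorization-extend : Σ (Factorization R D) λ E → ∀ x → Factorization.fun E d₀ x ≡ h.fun x
      Factorization-extend = record { factor = factor ; distinct = distinct ; covering = covering } , factor-d₀

  finite-factorization : {X Y : Set} {R : X → Y → Set} {D : Set} → ∀ n → D ≲ Fin n → Regular R D → Factorization R D
  finite-factorization {D = D} n le reg with em D
  ... | inj₂ empty = record
    { factor = λ d → ⊥-elim (empty d)
    ; distinct = λ c → ⊥-elim (empty c)
    ; covering = λ x y r → ⊥-elim (empty (proj₁ (proj₁ (proj₂ (proj₂ (proj₁ reg x)) y) r)))
    }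
  finite-factorization zero (f , _) reg | inj₁ d₀ = contradiction (f d₀) λ ()
  finite-factorization (suc n) le reg | inj₁ d₀ =
    let h = finite-regular-matching d₀ (suc n , le) reg
    in proj₁ (Factorization-extend d₀ h (finite-factorization n (≲-Fin-remove le d₀) (Regular-remove d₀ h reg)))

  factorization : {X Y : Set} {R : X → Y → Set} {D : Set} → Regular R D → Factorization R D
  factorization {D = D} reg with finite-or-infinite D
  ... | inj₁ (n , le) = finite-factorization n le reg
  ... | inj₂ inf = infinite-factorization inf reg

  -- For complementary relations the factors together join any `x` to any `y` by exactly one colour,
  -- as in a Latin square.
  Factorization-⊎ : {X Y C D : Set} {R S : X → Y → Set} → (∀ x y → R x y → ¬ S x y) → (∀ x y → R x y ⊎ S x y) →
    Factorization R C → Factorization S D → Factorization (λ (_ : X) (_ : Y) → ⊤) (C ⊎ D)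
  Factorization-⊎ {X} {Y} {C} {D} {S = S} disjoint total F G = record
    { factor = factor
    ; distinct = distinct
    ; covering = λ x y _ → covering x y
    }
    where
    module F = Factorization F
    module G = Factorization G
    factor : C ⊎ D → PerfectMatching (λ (_ : X) (_ : Y) → ⊤)
    factor (inj₁ c) = record { fun = F.fun c ; edge = λ _ → tt ; injective = F.injective c ; surjective = F.surjective c }
    factor (inj₂ d) = record { fun = G.fun d ; edge = λ _ → tt ; injective = G.injective d ; surjective = G.surjective d }
    covering : ∀ x y → ∃[ c ] PerfectMatching.fun (factor c) x ≡ y
    covering x y with total x y
    ... | inj₁ r = let (c , eq) = F.covering x y r in inj₁ c , eq
    ... | inj₂ s = let (d , eq) = G.covering x y s in inj₂ d , eq
    distinct : ∀ c d x → PerfectMatching.fun (factor c) x ≡ PerfectMatching.fun (factor d) x → c ≡ d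
    distinct (inj₁ c) (inj₁ d) x eq = cong inj₁ (F.distinct c d x eq)
    distinct (inj₁ c) (inj₂ d) x eq = ⊥-elim (disjoint x _ (F.edge c x) (subst (S x) (sym eq) (G.edge d x)))
    distinct (inj₂ c) (inj₁ d) x eq = ⊥-elim (disjoint x _ (F.edge d x) (subst (S x) eq (G.edge c x)))
    distinct (inj₂ c) (inj₂ d) x eq = cong inj₂ (G.distinct c d x eq)

  -- Generalized Cayley graphs of quasigroups

  module _ {V A : Set} (G : Graph V A) (G-nonempty : NonEmpty G) where

    -- From quasigroups to the graph conditions.

    module FromCayley (Rep : CayleyRep G) (quasi : IsQuasigroup G Rep) where
      open CayleyRep Rep

      -- `Q` is inhabited because `G` has an edge; hence every element of `M` has an outgoing edge
      -- and is a vertex.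
      q₀ : Q
      q₀ = let (s , a , t , e) = G-nonempty in proj₁ (proj₂ (proj₁ (edges s a t) e))

      edge : ∀ p q → G (ιM p) ⟨ q ⟩ (ιM (p ∙ ιQ q))
      edge p q = proj₂ (edges _ _ _) (p , q , refl , refl , refl)

      edge-to : ∀ {p q r} → p ∙ ιQ q ≡ r → G (ιM p) ⟨ q ⟩ (ιM r)
      edge-to refl = edge _ _

      cancelˡ : ∀ p {r s} → p ∙ r ≡ p ∙ s → r ≡ s
      cancelˡ p {r} {s} eq = let (_ , _ , u) = proj₁ (quasi p (p ∙ s)) in trans (u r eq) (sym (u s refl))

      cancelʳ : ∀ p {r s} → r ∙ p ≡ s ∙ p → r ≡ s
      cancelʳ p {r} {s} eq = let (_ , _ , u) = proj₂ (quasi p (s ∙ p)) in trans (u r eq) (sym (u s refl))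

      infixl 7 _\\_ _//_
      _\\_ : M → M → M
      p \\ q = proj₁ (proj₁ (quasi p q))

      _//_ : M → M → M
      q // p = proj₁ (proj₂ (quasi p q))

      ∙-\\ : ∀ p q → p ∙ (p \\ q) ≡ q
      ∙-\\ p q = proj₁ (proj₂ (proj₁ (quasi p q)))

      //-∙ : ∀ q p → (q // p) ∙ p ≡ q
      //-∙ q p = proj₁ (proj₂ (proj₂ (quasi p q)))

      InV-ι : ∀ p → InV G (ιM p)
      InV-ι p = inj₁ (_ , _ , edge p q₀)

      ι-InV : ∀ v → InV G v → ∃[ p ] v ≡ ιM p
      ι-InV v (inj₁ (a , t , e)) = let (p , q , eq , _) = proj₁ (edges v a t) e in p , eq
      ι-InV v (inj₂ (s , a , e)) = let (p , q , _ , _ , eq) = proj₁ (edges s a v) e in p ∙ ιQ q , eq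

      label-InA : ∀ a → InA G a → ∃[ q ] a ≡ ⟨ q ⟩
      label-InA a (s , t , e) = let (p , q , _ , eq , _) = proj₁ (edges s a t) e in q , eq

      edge⁻¹ : ∀ p q t → G (ιM p) ⟨ q ⟩ t → t ≡ ιM (p ∙ ιQ q)
      edge⁻¹ p q t e = let (p′ , q′ , eq , eq′ , eq″) = proj₁ (edges _ _ _) e in
        trans eq″ (cong ιM (cong₂ (λ p q → p ∙ ιQ q) (sym (ιM-inj _ _ eq)) (sym (⟨⟩-inj _ _ eq′))))

      simple : Simple G
      simple s t a b e e′ with proj₁ (edges s a t) e | proj₁ (edges s b t) e′
      ... | p , q , refl , refl , refl | p′ , q′ , eq , refl , eq″ with ιM-inj _ _ eq
      ... | refl = cong ⟨_⟩ (ιQ-inj _ _ (cancelˡ p (ιM-inj _ _ eq″)))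

      deterministic : Deterministic G
      deterministic r s t a e e′ with proj₁ (edges r a s) e
      ... | p , q , refl , refl , refl = sym (edge⁻¹ p q t e′)

      coDeterministic : CoDeterministic G
      coDeterministic r s t a e e′ with proj₁ (edges s a r) e | proj₁ (edges t a r) e′
      ... | p , q , refl , refl , refl | p′ , q′ , refl , eq , eq″ with ⟨⟩-inj _ _ eq
      ... | refl = cong ιM (cancelʳ (ιQ q) (ιM-inj _ _ eq″))

      sourceComplete : SourceComplete G
      sourceComplete s a s∈ a∈ with ι-InV s s∈ | label-InA a a∈
      ... | p , refl | q , refl = _ , edge p q

      targetComplete : TargetComplete G
      targetComplete t a t∈ a∈ with ι-InV t t∈ | label-InA a a∈
      ... | p , refl | q , refl = ιM (p // ιQ q) , edge-to (//-∙ p (ιQ q))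

      NonLabel : M → Set
      NonLabel m = ¬ (∃[ q ] ιQ q ≡ m)

      -- By left cancellation, an edge from `p` to `p ∙ m` can only come from an element of `Q`
      -- equal to `m`.
      nonArrow : ∀ p m → NonLabel m ⇔ NonArrow G (ιM p) (ιM (p ∙ m))
      nonArrow p m = (λ m∉Q → InV-ι p , InV-ι (p ∙ m) , λ (a , e) →
                        let (p′ , q , eq , _ , eq″) = proj₁ (edges _ _ _) e in
                        m∉Q (q , sym (cancelˡ p (trans (ιM-inj _ _ eq″) (cong (_∙ ιQ q) (sym (ιM-inj _ _ eq))))))) ,
                     (λ (_ , _ , none) → λ { (q , refl) → none (_ , edge p q) })

      coRegular : CoRegular G
      coRegular = Sub NonLabel , enum
        where
        enum : ∀ s → InV G s → HasCard G (λ t → NonArrow G s t) (Sub NonLabel) × HasCard G (λ t → NonArrow G t s) (Sub NonLabel)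
        enum s s∈ with ι-InV s s∈
        ... | p , refl =
          ((λ m → ιM (p ∙ proj₁ m)) , (λ m m′ eq → Sub-≡ (cancelˡ p (ιM-inj _ _ eq))) , λ t → out t ,
            λ { (m , refl) → proj₁ (nonArrow p (proj₁ m)) (holds m) }) ,
          ((λ m → ιM (p // proj₁ m)) , (λ m m′ eq → Sub-≡ (//-inj (ιM-inj _ _ eq))) , λ t → inn t ,
            λ { (m , refl) → subst (NonArrow G (ιM (p // proj₁ m)) ∘ ιM) (//-∙ p (proj₁ m)) (proj₁ (nonArrow (p // proj₁ m) (proj₁ m)) (holds m)) })
          where
          //-inj : ∀ {m m′} → p // m ≡ p // m′ → m ≡ m′
          //-inj {m} {m′} eq = cancelˡ (p // m) (trans (//-∙ p m) (trans (sym (//-∙ p m′)) (cong (_∙ m′) (sym eq))))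

          out : ∀ t → NonArrow G (ιM p) t → ∃[ m ] ιM (p ∙ proj₁ m) ≡ t
          out t na@(_ , t∈ , _) with ι-InV t t∈
          ... | r , refl = sub (p \\ r) (proj₂ (nonArrow p (p \\ r))
                  (subst (NonArrow G _ ∘ ιM) (sym (∙-\\ p r)) na)) , cong ιM (∙-\\ p r)

          inn : ∀ t → NonArrow G t (ιM p) → ∃[ m ] ιM (p // proj₁ m) ≡ t
          inn t na@(t∈ , _) with ι-InV t t∈
          ... | r , refl = sub (r \\ p) (proj₂ (nonArrow r (r \\ p))
                  (subst (NonArrow G _ ∘ ιM) (sym (∙-\\ r p)) na)) ,
                cong ιM (cancelʳ (r \\ p) (trans (//-∙ p (r \\ p)) (sym (∙-\\ r p))))

      condC : CondC G
      condC = simple , deterministic , coDeterministic , coRegular , sourceComplete , targetComplete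

      -- A loop gives `p ∙ ιQ q ≡ p`, so by cancellation its label names the right identity, which
      -- yields loops everywhere.
      loopComplete : HasRightIdentity G Rep → LoopComplete G
      loopComplete (e , idʳ) a (v , loop) w w∈ with proj₁ (edges v a v) loop | ι-InV w w∈
      ... | p , q , refl , refl , eq | p′ , refl =
        edge-to (trans (cong (p′ ∙_) ιq≡e) (idʳ p′))
        where
        ιq≡e : ιQ q ≡ e
        ιq≡e = cancelˡ p (trans (sym (ιM-inj _ _ eq)) (sym (idʳ p)))

    -- From the graph conditions to quasigroups.

    module ToCayley (condC : CondC G) where

      private
        simple = proj₁ condC
        deterministic = proj₁ (proj₂ condC)
        coDeterministic = proj₁ (proj₂ (proj₂ condC))
        coRegular = proj₁ (proj₂ (proj₂ (proj₂ condC)))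
        sourceComplete = proj₁ (proj₂ (proj₂ (proj₂ (proj₂ condC))))
        targetComplete = proj₂ (proj₂ (proj₂ (proj₂ (proj₂ condC))))

      Vertex : Set
      Vertex = Sub (InV G)

      Label : Set
      Label = Sub (InA G)

      D : Set
      D = proj₁ coRegular

      Edge NonEdge : Vertex → Vertex → Set
      Edge s t = Arrow G (proj₁ s) (proj₁ t)
      NonEdge s t = NonArrow G (proj₁ s) (proj₁ t)

      follow : ∀ (a : Label) (s : Vertex) → ∃[ t ] G (proj₁ s) (proj₁ a) (proj₁ t)
      follow a s = let (t , e) = sourceComplete (proj₁ s) (proj₁ a) (holds s) (holds a)
                   in sub {P = InV G} t (inj₂ (_ , _ , e)) , e

      -- Each label is a factor: source-completeness and determinism make it a map, co-determinism
      -- and target-completeness a bijection, and simplicity separates different labels.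
      edge-factorization : Factorization Edge Label
      edge-factorization = record
        { factor = λ a → record
          { fun = λ s → proj₁ (follow a s)
          ; edge = λ s → _ , proj₂ (follow a s)
          ; injective = λ s s′ eq → Sub-≡ (coDeterministic _ _ _ _ (proj₂ (follow a s))
              (subst (λ t → G (proj₁ s′) (proj₁ a) (proj₁ t)) (sym eq) (proj₂ (follow a s′))))
          ; surjective = λ t →
              let (s , e) = targetComplete (proj₁ t) (proj₁ a) (holds t) (holds a)
                  s′ = sub {P = InV G} s (inj₁ (_ , _ , e))
              in s′ , Sub-≡ (deterministic _ _ _ _ (proj₂ (follow a s′)) e)
          }
        ; distinct = λ a b s eq → Sub-≡ (simple _ _ _ _ (proj₂ (follow a s))
            (subst (λ t → G (proj₁ s) (proj₁ b) (proj₁ t)) (sym eq) (proj₂ (follow b s))))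
        ; covering = λ s t (a , e) → sub {P = InA G} a (_ , _ , e) , Sub-≡ (deterministic _ _ _ _ (proj₂ (follow _ s)) e)
        }

      Enum-Vertex : {P : V → Set} → (∀ v → P v → InV G v) → Enum P D → Enum (P ∘ proj₁) D
      Enum-Vertex P⊆ (f , f-inj , f-img) =
        (λ d → sub {P = InV G} (f d) (P⊆ _ (proj₂ (f-img _) (d , refl)))) , (λ c d eq → f-inj c d (cong proj₁ eq)) ,
        λ t → (λ p → let (d , eq) = proj₁ (f-img _) p in d , Sub-≡ eq) ,
              (λ (d , eq) → proj₂ (f-img _) (d , cong proj₁ eq))

      NonEdge-regular : Regular NonEdge D
      NonEdge-regular =
        (λ s → Enum-Vertex (λ _ na → proj₁ (proj₂ na)) (proj₁ (proj₂ coRegular (proj₁ s) (holds s)))) ,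
        (λ t → Enum-Vertex (λ _ → proj₁) (proj₂ (proj₂ coRegular (proj₁ t) (holds t))))

      edge-or-not : ∀ s t → Edge s t ⊎ NonEdge s t
      edge-or-not s t with em (Edge s t)
      ... | inj₁ e = inj₁ e
      ... | inj₂ none = inj₂ (holds s , holds t , none)

      r : Vertex
      r = let (s , a , t , e) = G-nonempty in sub s (inj₁ (a , t , e))

      -- The edges leaving r, coloured by the factors, name every vertex by a colour;
      -- multiplication by q on the right is the factor of the colour naming q.
      module _ (F : Factorization NonEdge D) where

        open Factorization (Factorization-⊎ (λ s t e (_ , _ , none) → none e) edge-or-not edge-factorization F)

        colour : Vertex → Label ⊎ D
        colour q = proj₁ (covering r q tt)

        colour-fun : ∀ c → colour (fun c r) ≡ c
        colour-fun c = distinct _ _ r (proj₂ (covering r (fun c r) tt))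

        rep : CayleyRep G
        rep = record
          { M = Vertex
          ; ιM = proj₁
          ; ιM-inj = λ _ _ → Sub-≡
          ; _∙_ = λ p q → fun (colour q) p
          ; Q = Label
          ; ιQ = λ a → fun (inj₁ a) r
          ; ιQ-inj = λ a b eq → inj₁-injective (distinct _ _ r eq)
          ; ⟨_⟩ = proj₁
          ; ⟨⟩-inj = λ _ _ → Sub-≡
          ; edges = λ s a t →
              (λ e → let p = sub {P = InV G} s (inj₁ (_ , _ , e))
                         q = sub {P = InA G} a (_ , _ , e)
                     in p , q , refl , refl ,
                        trans (deterministic _ _ _ _ e (proj₂ (follow q p)))
                          (cong (λ c → proj₁ (fun c p)) (sym (colour-fun (inj₁ q))))) ,
              λ { (p , q , refl , refl , refl) →
                  subst (λ c → G (proj₁ p) (proj₁ q) (proj₁ (fun c p))) (sym (colour-fun (inj₁ q))) (proj₂ (follow q p)) }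
          }

        -- The right factor is found from the unique colour joining `p` to `q`, the left factor from
        -- the bijectivity of the matching of `colour p`.
        quasigroup : IsQuasigroup G rep
        quasigroup p q =
          (let (c , eq) = covering p q tt in fun c r , trans (cong (λ d → fun d p) (colour-fun c)) eq ,
            λ u eq′ → trans (sym (proj₂ (covering r u tt)))
              (cong (λ d → fun d r) (distinct (colour u) c p (trans eq′ (sym eq))))) ,
          (let (s , eq) = surjective (colour p) q in s , eq , λ u eq′ → injective (colour p) u s (trans eq′ (sym eq)))

        leftIdentity : ∀ q → fun (colour q) r ≡ q
        leftIdentity q = proj₂ (covering r q tt)

        cayleyLeftId : CayleyQuasigroupLeftId G
        cayleyLeftId = rep , quasigroup , r , leftIdentity

        -- A colour acting as the identity fixes `r`, so it is the colour naming `r`, and right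
        -- multiplication by `r` is trivial.
        cayleyId : (c : Label ⊎ D) → (∀ s → fun c s ≡ s) → CayleyQuasigroupId G
        cayleyId c fix = rep , quasigroup , r , leftIdentity ,
          λ p → trans (cong (λ d → fun d p) (trans (cong colour (sym (fix r))) (colour-fun c))) (fix p)

      condC⇒leftId : CayleyQuasigroupLeftId G
      condC⇒leftId = cayleyLeftId (factorization NonEdge-regular)

      condC′⇒id : LoopComplete G → CayleyQuasigroupId G
      condC′⇒id loopComplete with em (∃[ a ] ∃[ v ] G v a v)
      ... | inj₁ (a , v , loop) = cayleyId (factorization NonEdge-regular) (inj₁ ℓ) λ s →
              Sub-≡ (deterministic _ _ _ _ (proj₂ (follow ℓ s)) (loopComplete a (v , loop) (proj₁ s) (holds s)))
        where
        ℓ : Label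
        ℓ = sub a (v , v , loop)
      ... | inj₂ loopless = cayleyId (proj₁ F) (inj₂ d₀) (proj₂ F)
        where
        diagonal : PerfectMatching NonEdge
        diagonal = record
          { fun = id
          ; edge = λ s → holds s , holds s , λ (a , e) → loopless (a , proj₁ s , e)
          ; injective = λ _ _ eq → eq
          ; surjective = λ s → s , refl
          }
        d₀ : D
        -- The index of the non-edge from `r` to itself shows that `D` has an element to assign to
        -- the diagonal.
        d₀ = proj₁ (proj₁ (proj₂ (proj₂ (proj₁ NonEdge-regular r)) r) (PerfectMatching.edge diagonal r))
        F = Factorization-extend d₀ diagonal (factorization (Regular-remove d₀ diagonal NonEdge-regular))

theorem7p8 : Classical → {V A : Set} (G : Graph V A) → NonEmpty G →
    ((CayleyQuasigroup G ⇔ CayleyQuasigroupLeftId G) × (CayleyQuasigroupLeftId G ⇔ CondC G))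
    × ((CayleyQuasigroupRightId G ⇔ CayleyQuasigroupId G) × (CayleyQuasigroupId G ⇔ CondC' G))
theorem7p8 classical G ne =
  (((λ (R , quasi) → condC⇒leftId (condC R quasi)) , (λ (R , quasi , _) → R , quasi)) ,
   ((λ (R , quasi , _) → condC R quasi) , condC⇒leftId)) ,
  (((λ (R , quasi , right) → condC′⇒id (condC R quasi) (loopComplete R quasi right)) ,
    (λ (R , quasi , e , _ , right) → R , quasi , e , right)) ,
   ((λ (R , quasi , e , _ , right) → condC R quasi , loopComplete R quasi (e , right)) ,
    (λ (c , loops) → condC′⇒id c loops)))
  where
  open FromCayley classical G ne using (condC; loopComplete)
  open ToCayley classical G ne using (condC⇒leftId; condC′⇒id)
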